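{- For every claw-free bridgeless cubic graph $G$ and every edge $e$ of $G$, there is a perfect matching $F$ of $G$ with $e\in F$ such that $G/\overline{F}$ admits a non-conflicting nowhere-zero $\mathbb{Z}_2\times\mathbb{Z}_2$-flow with respect to $\overline{F}$.
   Context: Graphs are finite, loopless, and may have parallel edges. A graph is claw-free if it has no four vertices inducing a subgraph isomorphic to $K_{1,3}$. For a perfect matching $F$ of a cubic graph $G$, $\overline{F}=G-F$ is the complementary 2-factor, and $G/\overline{F}$ is the pseudo-graph obtained by contracting each cycle of $\overline{F}$ to a vertex; its edges are the edges of $F$ (edges of $F$ with both ends on one cycle become loops). Write $\mathbb{Z}_2\times\mathbb{Z}_2=\{0,\alpha,\beta,\alpha+\beta\}$. A nowhere-zero $\mathbb{Z}_2\times\mathbb{Z}_2$-flow is an assignment $\theta$ of nonzero elements to the edges such that at every vertex the sum of values on incident edges is $0$ (loops counted twice). Such a flow of $G/\overline{F}$ is non-conflicting with respect to $\overline{F}$ if no edge $uv$ of $\overline{F}$ has $u$ incident to an edge of $F$ with value $\alpha$ and $v$ incident to an edge of $F$ with value $\beta$. -}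

module Defs where

open import Data.Nat using (ℕ; zero; suc; _+_)
open import Data.Fin using (Fin; zero; suc; _≟_)
open import Data.Bool using (Bool; true; false; _∧_; _∨_; not; if_then_else_; _xor_)
open import Data.Product using (Σ; _×_; _,_; proj₁; proj₂; ∃-syntax)
open import Data.Sum using (_⊎_)
open import Relation.Nullary using (¬_; does)
open import Relation.Binary.PropositionalEquality using (_≡_; _≢_)

-- Finite loopless multigraphs: vertices Fin n, edges Fin m, each edge
-- has an (unordered) pair of distinct ends.  Parallel edges allowed.

record Graph : Set where
  field
    n : ℕ
    m : ℕ
    ends : Fin m → Fin n × Fin n
    loopless : ∀ e → proj₁ (ends e) ≢ proj₂ (ends e)

open Graph public

sumℕ : ∀ {k} → (Fin k → ℕ) → ℕ
sumℕ {zero} f = 0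
sumℕ {suc k} f = f zero + sumℕ (λ i → f (suc i))

anyFin : ∀ {k} → (Fin k → Bool) → Bool
anyFin {zero} f = false
anyFin {suc k} f = f zero ∨ anyFin (λ i → f (suc i))

eqB : ∀ {k} → Fin k → Fin k → Bool
eqB a b = does (a ≟ b)

b2n : Bool → ℕ
b2n true = 1
b2n false = 0

module _ (G : Graph) where
  end₁ end₂ : Fin (m G) → Fin (n G)
  end₁ e = proj₁ (ends G e)
  end₂ e = proj₂ (ends G e)

  incid : Fin (m G) → Fin (n G) → ℕ
  incid e v = b2n (eqB (end₁ e) v) + b2n (eqB (end₂ e) v)

  degree : Fin (n G) → ℕ
  degree v = sumℕ (λ e → incid e v)

  Cubic : Set
  Cubic = ∀ v → degree v ≡ 3

  joinsB : Fin (m G) → Fin (n G) → Fin (n G) → Bool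
  joinsB e u w = (eqB (end₁ e) u ∧ eqB (end₂ e) w) ∨ (eqB (end₁ e) w ∧ eqB (end₂ e) u)

  mult : Fin (n G) → Fin (n G) → ℕ
  mult u w = sumℕ (λ e → b2n (joinsB e u w))

  InducedClaw : Fin (n G) → Fin (n G) → Fin (n G) → Fin (n G) → Set
  InducedClaw v a b c =
    (v ≢ a × v ≢ b × v ≢ c × a ≢ b × a ≢ c × b ≢ c) ×
    (mult v a ≡ 1 × mult v b ≡ 1 × mult v c ≡ 1) ×
    (mult a b ≡ 0 × mult a c ≡ 0 × mult b c ≡ 0)

  ClawFree : Set
  ClawFree = ¬ (∃[ v ] ∃[ a ] ∃[ b ] ∃[ c ] InducedClaw v a b c)

  data Walk (P : Fin (m G) → Set) : Fin (n G) → Fin (n G) → Set where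
    here : ∀ {u} → Walk P u u
    step : ∀ {u w v} (g : Fin (m G)) → P g → joinsB g u w ≡ true →
           Walk P w v → Walk P u v

  Bridgeless : Set
  Bridgeless = ∀ e → Walk (λ g → g ≢ e) (end₁ e) (end₂ e)

  EdgeSet : Set
  EdgeSet = Fin (m G) → Bool

  PerfectMatching : EdgeSet → Set
  PerfectMatching F = ∀ v → sumℕ (λ e → if F e then incid e v else 0) ≡ 1

  reachF : EdgeSet → ℕ → Fin (n G) → Fin (n G) → Bool
  reachF F zero u x = eqB u x
  reachF F (suc k) u x =
    reachF F k u x ∨
    anyFin (λ g → not (F g) ∧
      ((reachF F k u (end₁ g) ∧ eqB (end₂ g) x) ∨
       (reachF F k u (end₂ g) ∧ eqB (end₁ g) x)))

  -- u and x lie on the same cycle (component) of F̄ = G - F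
  sameCycle : EdgeSet → Fin (n G) → Fin (n G) → Bool
  sameCycle F u x = reachF F (n G) u x

K : Set
K = Bool × Bool

0K α β : K
0K = false , false
α = true , false
β = false , true

_+K_ : K → K → K
(a , b) +K (c , d) = (a xor c) , (b xor d)

sumK : ∀ {k} → (Fin k → K) → K
sumK {zero} f = 0K
sumK {suc k} f = f zero +K sumK (λ i → f (suc i))

module _ (G : Graph) where
  -- G / F̄ has one vertex per cycle of F̄ and edge set F.  The flow sum at
  -- the contracted vertex containing u: each end of each F-edge lying on
  -- the cycle of u contributes θ f (so loops are counted twice).
  flowSumAt : EdgeSet G → (Fin (m G) → K) → Fin (n G) → K
  flowSumAt F θ u = sumK (λ f →
    if F f
    then ((if sameCycle G F u (end₁ G f) then θ f else 0K) +K
          (if sameCycle G F u (end₂ G f) then θ f else 0K))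
    else 0K)

  -- nowhere-zero Z2×Z2-flow of G / F̄ (θ is only relevant on F)
  NZFlow : EdgeSet G → (Fin (m G) → K) → Set
  NZFlow F θ = (∀ f → F f ≡ true → θ f ≢ 0K) × (∀ u → flowSumAt F θ u ≡ 0K)

  FEdgeAt : EdgeSet G → Fin (m G) → Fin (n G) → Set
  FEdgeAt F f v = F f ≡ true × (end₁ G f ≡ v ⊎ end₂ G f ≡ v)

  NonConflicting : EdgeSet G → (Fin (m G) → K) → Set
  NonConflicting F θ = ∀ g → F g ≡ false → ∀ u v → joinsB G g u v ≡ true →
    ∀ f₁ f₂ → FEdgeAt F f₁ u → FEdgeAt F f₂ v → ¬ (θ f₁ ≡ α × θ f₂ ≡ β)

{-# OPTIONS --safe #-}

-- If every T-cut has at least three edges, a minimum-weight T-join weighs at most a third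
-- of all edges: subtracting 1 from the weights along a suitable cut lowers the join by 1 and
-- the total by at least 3.  With T = V and weights that count 3-cuts and slightly favour e,
-- this yields a perfect matching F ∋ e that meets every 3-cut exactly once.  So G / F̄ has no
-- cut of size 1 or 3.  Contracting one edge of each 2-cut leaves only cuts of size at least 4,
-- hence (Nash-Williams) two disjoint spanning forests; the complement of each extends to a
-- cycle, and these two cycles cover F and are the coordinates of a flow (Jaeger).
-- Finally give every loop of G / F̄ the value α + β.  A conflict across an edge uv of F̄ then
-- forces, by claw-freeness, an F̄-digon or an F̄-triangle through uv: the former is left by a
-- 2-cut, whose two edges carry equal values, and the latter by a 3-cut contained in F.
module Submission where

open import Defs
open import Data.Fin using (Fin)
open import Data.Bool using (Bool; true)
open import Data.Product using (Σ; _×_)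
open import Relation.Binary.PropositionalEquality using (_≡_)

open import Data.Nat using (ℕ; zero; suc; _+_; _*_; _∸_; _^_; _≤_; _<_; z≤n; s≤s; s≤s⁻¹)
import Data.Nat as ℕ
open import Data.Nat.Properties hiding (_≟_; suc-injective)
open import Algebra.Bundles using (module CommutativeRing)
open import Algebra.Properties.CommutativeSemigroup +-commutativeSemigroup using (interchange)
open import Data.Nat.Solver using (module +-*-Solver)
open import Data.Fin using (zero; suc; _≟_; finToFun; funToFin)
import Data.Fin as Fin
open import Data.Fin.Properties using (finToFun-funToFin; suc-injective; any?; all?; ¬∀⟶∃¬)
import Data.Fin.Properties as Fin
open import Data.Bool using (false; _∧_; _∨_; not; if_then_else_; _xor_)
import Data.Bool as Bool
open import Data.Bool.Properties using (not-involutive; ∧-comm; ∧-zeroʳ; ∧-identityʳ; ∨-comm; xor-same; xor-assoc; xor-comm; xor-identityʳ; ∧-distribˡ-xor; ∧-distribʳ-xor; xor-∧-commutativeRing)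
open import Algebra.Properties.CommutativeSemigroup (CommutativeRing.+-commutativeSemigroup xor-∧-commutativeRing)
  using () renaming (interchange to xor-interchange)
open import Data.Bool.Solver using (module xor-∧-Solver)
open import Data.List using (List; []; _∷_; allFin)
open import Data.List.Membership.Propositional using (_∈_)
open import Data.List.Membership.Propositional.Properties using (∈-allFin)
open import Data.List.Relation.Unary.Any using (here; there)
open import Data.Product using (_,_; proj₁; proj₂; ∃-syntax)
import Data.Product.Properties as Product
open import Data.Sum using (_⊎_; inj₁; inj₂)
import Data.Sum as Sum
open import Data.Empty using (⊥; ⊥-elim)
open import Function using (_∘_)
open import Relation.Nullary using (¬_; Dec; yes; no; does; contradiction; ¬?; _×-dec_; _→-dec_)
open import Relation.Nullary.Decidable using (map′; dec-true; dec-false; decidable-stable; toWitness)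
open import Relation.Binary using (tri<; tri≈; tri>)
open import Relation.Binary.PropositionalEquality hiding (J)

-- The delicate step is the bound by a third. Peeling off one cut per unit of weight of the join
-- needs a parity condition: `w` must be even on every cycle (with unit weights this is
-- bipartiteness, the setting of Seymour's theorem on packing T-cuts). Without it a suitable cut may
-- not exist: in the complete graph on four vertices with unit weights and `T = V`, lowering the
-- star of a vertex makes that star a T-join of weight 0, below every perfect matching. Peeling
-- preserves the condition because cycles cross cuts evenly, so it suffices to start from even
-- weights; this is why the counts of 3-cuts and the bonus for `e` are both multiplied by even
-- numbers. Paths are never vertex sequences. Cycles and joins are known only by the parities with
-- which they meet cuts, and the existence of a path is read off from connectivity. `G` may be
-- disconnected, which is why component counts are compared with `r`, the count for all edges, and
-- not with 1.

bool-cases : ∀ b → b ≡ true ⊎ b ≡ false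
bool-cases true = inj₁ refl
bool-cases false = inj₂ refl

true≢false : ∀ {b} → b ≡ true → b ≡ false → ⊥
true≢false refl ()

≢true : ∀ {b} → b ≢ true → b ≡ false
≢true {true} b≢ = ⊥-elim (b≢ refl)
≢true {false} _ = refl

∧-true : ∀ {a b} → a ∧ b ≡ true → a ≡ true × b ≡ true
∧-true {true} {true} _ = refl , refl

∨-true : ∀ {a b} → a ∨ b ≡ true → a ≡ true ⊎ b ≡ true
∨-true {true} _ = inj₁ refl
∨-true {false} p = inj₂ p

∨-trueʳ : ∀ a {b} → b ≡ true → a ∨ b ≡ true
∨-trueʳ true _ = refl
∨-trueʳ false p = p

∨-trueˡ : ∀ {a} b → a ≡ true → a ∨ b ≡ true
∨-trueˡ _ refl = refl

xor-true : ∀ {a b} → a xor b ≡ true → (a ≡ true × b ≡ false) ⊎ (a ≡ false × b ≡ true)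
xor-true {true} {false} _ = inj₁ (refl , refl)
xor-true {false} {true} _ = inj₂ (refl , refl)

xor-false : ∀ {a b} → a xor b ≡ false → a ≡ b
xor-false {true} {true} _ = refl
xor-false {false} {false} _ = refl

not-false : ∀ {a} → not a ≡ false → a ≡ true
not-false {true} _ = refl

not-true : ∀ {a} → not a ≡ true → a ≡ false
not-true {false} _ = refl

eqB-refl : ∀ {k} (a : Fin k) → eqB a a ≡ true
eqB-refl a = dec-true (a ≟ a) refl

eqB-≢ : ∀ {k} {a b : Fin k} → a ≢ b → eqB a b ≡ false
eqB-≢ {a = a} {b} a≢b = dec-false (a ≟ b) a≢b

eqB-true : ∀ {k} (a b : Fin k) → eqB a b ≡ true → a ≡ b
eqB-true a b p with a ≟ b
... | yes q = q
... | no _ = contradiction p λ ()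

anyFin-true : ∀ {k} (f : Fin k → Bool) → anyFin f ≡ true → ∃[ i ] f i ≡ true
anyFin-true {suc k} f p with ∨-true {f zero} p
... | inj₁ q = zero , q
... | inj₂ q with anyFin-true (λ i → f (suc i)) q
...   | i , r = suc i , r

anyFin-intro : ∀ {k} (f : Fin k → Bool) i → f i ≡ true → anyFin f ≡ true
anyFin-intro f zero p = ∨-trueˡ _ p
anyFin-intro f (suc i) p = ∨-trueʳ (f zero) (anyFin-intro (λ j → f (suc j)) i p)

anyFin-cong : ∀ {k} {f g : Fin k → Bool} → f ≗ g → anyFin f ≡ anyFin g
anyFin-cong {zero} p = refl
anyFin-cong {suc k} p = cong₂ _∨_ (p zero) (anyFin-cong (λ i → p (suc i)))

-- Sums over Fin k

sum-cong : ∀ {k} {f g : Fin k → ℕ} → f ≗ g → sumℕ f ≡ sumℕ g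
sum-cong {zero} p = refl
sum-cong {suc k} p = cong₂ _+_ (p zero) (sum-cong (λ i → p (suc i)))

sum-mono : ∀ {k} {f g : Fin k → ℕ} → (∀ i → f i ≤ g i) → sumℕ f ≤ sumℕ g
sum-mono {zero} p = z≤n
sum-mono {suc k} p = +-mono-≤ (p zero) (sum-mono (λ i → p (suc i)))

sum-+ : ∀ {k} (f g : Fin k → ℕ) → sumℕ (λ i → f i + g i) ≡ sumℕ f + sumℕ g
sum-+ {zero} f g = refl
sum-+ {suc k} f g =
  trans (cong (f zero + g zero +_) (sum-+ (λ i → f (suc i)) (λ i → g (suc i))))
        (interchange (f zero) (g zero) _ _)

sum-0 : ∀ k → sumℕ {k} (λ _ → 0) ≡ 0
sum-0 zero = refl
sum-0 (suc k) = sum-0 k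

sum-1 : ∀ k → sumℕ {k} (λ _ → 1) ≡ k
sum-1 zero = refl
sum-1 (suc k) = cong suc (sum-1 k)

sum-swap : ∀ {k l} (f : Fin k → Fin l → ℕ) →
  sumℕ (λ i → sumℕ (f i)) ≡ sumℕ (λ j → sumℕ (λ i → f i j))
sum-swap {zero} {l} f = sym (sum-0 l)
sum-swap {suc k} f =
  trans (cong (sumℕ (f zero) +_) (sum-swap (λ i → f (suc i))))
        (sym (sum-+ (f zero) (λ j → sumℕ (λ i → f (suc i) j))))

sum-* : ∀ {k} c (f : Fin k → ℕ) → sumℕ (λ i → c * f i) ≡ c * sumℕ f
sum-* {zero} c f = sym (*-zeroʳ c)
sum-* {suc k} c f =
  trans (cong (c * f zero +_) (sum-* c (λ i → f (suc i)))) (sym (*-distribˡ-+ c (f zero) _))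

term≤sum : ∀ {k} (f : Fin k → ℕ) i → f i ≤ sumℕ f
term≤sum f zero = m≤m+n _ _
term≤sum f (suc i) = ≤-trans (term≤sum (λ j → f (suc j)) i) (m≤n+m _ (f zero))

sum-pos : ∀ {k} (f : Fin k → ℕ) → 0 < sumℕ f → ∃[ i ] 0 < f i
sum-pos {suc k} f p with f zero in eq
... | suc a = zero , subst (0 <_) (sym eq) (s≤s z≤n)
... | zero with sum-pos (λ i → f (suc i)) p
...   | i , q = suc i , q

count : ∀ {k} → (Fin k → Bool) → ℕ
count Q = sumℕ (λ i → b2n (Q i))

count-cong : ∀ {k} {P Q : Fin k → Bool} → P ≗ Q → count P ≡ count Q
count-cong p = sum-cong (λ i → cong b2n (p i))

b2n-mono : ∀ {a b} → (a ≡ true → b ≡ true) → b2n a ≤ b2n b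
b2n-mono {false} _ = z≤n
b2n-mono {true} p rewrite p refl = ≤-refl

b2n≤1 : ∀ b → b2n b ≤ 1
b2n≤1 true = ≤-refl
b2n≤1 false = z≤n

count-mono : ∀ {k} {P Q : Fin k → Bool} → (∀ i → P i ≡ true → Q i ≡ true) → count P ≤ count Q
count-mono p = sum-mono (λ i → b2n-mono (p i))

count≤ : ∀ {k} (P : Fin k → Bool) → count P ≤ k
count≤ {k} P = ≤-trans (sum-mono (λ i → b2n≤1 (P i))) (≤-reflexive (sum-1 k))

count-empty : ∀ {k} {P : Fin k → Bool} → (∀ i → P i ≡ false) → count P ≡ 0
count-empty {k} p = trans (count-cong p) (sum-0 k)

count-pos : ∀ {k} (P : Fin k → Bool) i → P i ≡ true → 1 ≤ count P
count-pos P i p = ≤-trans (≤-reflexive (cong b2n (sym p))) (term≤sum _ i)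

count-witness : ∀ {k} (P : Fin k → Bool) → 0 < count P → ∃[ i ] P i ≡ true
count-witness P p with sum-pos _ p
... | i , q = i , b2n-pos q
  where
  b2n-pos : ∀ {b} → 0 < b2n b → b ≡ true
  b2n-pos {true} _ = refl

count-unique : ∀ {k} (P : Fin k → Bool) →
  (∀ i j → P i ≡ true → P j ≡ true → i ≡ j) → count P ≤ 1
count-unique {zero} P u = z≤n
count-unique {suc k} P u with P zero in eq
... | true = s≤s (≤-reflexive (count-empty (λ i → ≢true λ q → contradiction (u zero (suc i) eq q) λ ())))
... | false = count-unique (λ i → P (suc i)) (λ i j p q → suc-injective (u (suc i) (suc j) p q))

count-eqB : ∀ {k} (a : Fin k) → count (eqB a) ≡ 1
count-eqB a = ≤-antisym
  (count-unique (eqB a) (λ i j p q → trans (sym (eqB-true a i p)) (eqB-true a j q)))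
  (count-pos (eqB a) a (eqB-refl a))

count-strict : ∀ {k} {P Q : Fin k → Bool} → (∀ i → P i ≡ true → Q i ≡ true) →
  ∀ j → P j ≡ false → Q j ≡ true → suc (count P) ≤ count Q
count-strict {P = P} {Q} sub j pj qj = begin
  suc (count P) ≡⟨ cong (_+ count P) (sym (count-eqB j)) ⟩
  count (eqB j) + count P ≡⟨ sym (sum-+ (b2n ∘ eqB j) (b2n ∘ P)) ⟩
  sumℕ (λ i → b2n (eqB j i) + b2n (P i)) ≤⟨ sum-mono bound ⟩
  count Q ∎
  where
  open ≤-Reasoning
  bound : ∀ i → b2n (eqB j i) + b2n (P i) ≤ b2n (Q i)
  bound i with j ≟ i
  ... | no _ = b2n-mono (sub i)
  ... | yes refl rewrite pj | qj = ≤-refl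

-- Sums mod 2

xsum : ∀ {k} → (Fin k → Bool) → Bool
xsum {zero} f = false
xsum {suc k} f = f zero xor xsum (λ i → f (suc i))

xsum-cong : ∀ {k} {f g : Fin k → Bool} → f ≗ g → xsum f ≡ xsum g
xsum-cong {zero} p = refl
xsum-cong {suc k} p = cong₂ _xor_ (p zero) (xsum-cong (λ i → p (suc i)))

xsum-xor : ∀ {k} (f g : Fin k → Bool) → xsum (λ i → f i xor g i) ≡ xsum f xor xsum g
xsum-xor {zero} f g = refl
xsum-xor {suc k} f g =
  trans (cong ((f zero xor g zero) xor_) (xsum-xor (λ i → f (suc i)) (λ i → g (suc i))))
        (xor-interchange (f zero) (g zero) _ _)

xsum-false : ∀ {k} {f : Fin k → Bool} → (∀ i → f i ≡ false) → xsum f ≡ false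
xsum-false {zero} p = refl
xsum-false {suc k} p rewrite p zero = xsum-false (λ i → p (suc i))

xsum-swap : ∀ {k l} (f : Fin k → Fin l → Bool) →
  xsum (λ i → xsum (f i)) ≡ xsum (λ j → xsum (λ i → f i j))
xsum-swap {zero} {l} f = sym (xsum-false {l} (λ _ → refl))
xsum-swap {suc k} f =
  trans (cong (xsum (f zero) xor_) (xsum-swap (λ i → f (suc i))))
        (sym (xsum-xor (f zero) (λ j → xsum (λ i → f (suc i) j))))

xsum-∧ : ∀ {k} b (f : Fin k → Bool) → xsum (λ i → b ∧ f i) ≡ b ∧ xsum f
xsum-∧ true f = refl
xsum-∧ {k} false f = xsum-false {k} (λ _ → refl)

xsum-witness : ∀ {k} (f : Fin k → Bool) → xsum f ≡ true → ∃[ i ] f i ≡ true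
xsum-witness {suc k} f p with f zero in eq
... | true = zero , eq
... | false with xsum-witness (λ i → f (suc i)) p
...   | i , q = suc i , q

par : ℕ → Bool
par zero = false
par (suc k) = not (par k)

par-+ : ∀ a b → par (a + b) ≡ par a xor par b
par-+ zero b = refl
par-+ (suc a) b = trans (cong not (par-+ a b)) (not-xor (par a) (par b))
  where
  not-xor : ∀ x y → not (x xor y) ≡ not x xor y
  not-xor true true = refl
  not-xor true false = refl
  not-xor false y = refl

par-count : ∀ {k} (P : Fin k → Bool) → par (count P) ≡ xsum P
par-count {zero} P = refl
par-count {suc k} P =
  trans (par-+ (b2n (P zero)) _) (cong₂ _xor_ (par-b2n (P zero)) (par-count (λ i → P (suc i))))
  where
  par-b2n : ∀ b → par (b2n b) ≡ b
  par-b2n true = refl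
  par-b2n false = refl

xsum-eqB : ∀ {k} (a : Fin k) (f : Fin k → Bool) → xsum (λ i → eqB a i ∧ f i) ≡ f a
xsum-eqB {suc k} zero f =
  trans (cong (f zero xor_) (xsum-false {k} (λ _ → refl))) (xor-identityʳ (f zero))
xsum-eqB (suc a) f = xsum-eqB a (λ i → f (suc i))

-- Exhaustive search over Boolean functions

fromFin : Fin 2 → Bool
fromFin zero = false
fromFin (suc _) = true

toFin : Bool → Fin 2
toFin false = zero
toFin true = suc zero

from-to : ∀ b → fromFin (toFin b) ≡ b
from-to true = refl
from-to false = refl

enum : ∀ {k} → Fin (2 ^ k) → Fin k → Bool
enum i j = fromFin (finToFun i j)

code : ∀ {k} → (Fin k → Bool) → Fin (2 ^ k)
code f = funToFin (λ j → toFin (f j))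

enum-code : ∀ {k} (f : Fin k → Bool) → enum (code f) ≗ f
enum-code f j = trans (cong fromFin (finToFun-funToFin (λ i → toFin (f i)) j)) (from-to (f j))

-- Functions are compared pointwise, without extensionality; an enumeration hits each function only
-- up to `≗`, so a searched property has to respect it.
Resp : ∀ {k} → ((Fin k → Bool) → Set) → Set
Resp {k} P = ∀ {f g : Fin k → Bool} → f ≗ g → P f → P g

search : ∀ {k} {P : (Fin k → Bool) → Set} → Resp P → (∀ f → Dec (P f)) → Dec (Σ (Fin k → Bool) P)
search resp P? = map′ (λ (i , p) → enum i , p)
  (λ (f , p) → code f , resp (λ j → sym (enum-code f j)) p) (any? (λ i → P? (enum i)))

all-fun? : ∀ {k} {P : (Fin k → Bool) → Set} → Resp P → (∀ f → Dec (P f)) → Dec (∀ f → P f)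
all-fun? {k} {P} resp P? with search {P = λ f → ¬ P f} (λ e ¬p p → ¬p (resp (λ j → sym (e j)) p)) (λ f → ¬? (P? f))
... | yes (f , ¬p) = no (λ all → ¬p (all f))
... | no none = yes (λ f → decidable-stable (P? f) (λ ¬p → none (f , ¬p)))

minimise : ∀ {k} {P : (Fin k → Bool) → Set} → Resp P → (∀ f → Dec (P f)) →
  (v : (Fin k → Bool) → ℕ) → (∀ {f g} → f ≗ g → v f ≡ v g) → Σ (Fin k → Bool) P →
  Σ (Fin k → Bool) λ f → P f × (∀ g → P g → v f ≤ v g)
minimise {k} {P} resp P? v v-cong (f₀ , p₀) = go (suc (v f₀)) f₀ p₀ ≤-refl
  where
  better? : ∀ f → Dec (Σ (Fin k → Bool) λ g → P g × v g < v f)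
  better? f = search (λ e (p , l) → resp e p , subst (_< v f) (v-cong e) l)
    (λ g → P? g ×-dec (v g <? v f))
  go : ∀ b f → P f → v f < b → Σ (Fin k → Bool) λ f → P f × (∀ g → P g → v f ≤ v g)
  go (suc b) f p (s≤s lt) with better? f
  ... | yes (g , q , l) = go b g q (<-≤-trans l lt)
  ... | no none = f , p , λ g q → ≮⇒≥ (λ l → none (g , q , l))

-- Symmetric difference and inclusion of finite sets.

infixl 6 _⊕_
_⊕_ : ∀ {k} → (Fin k → Bool) → (Fin k → Bool) → Fin k → Bool
(P ⊕ Q) i = P i xor Q i

∅ : ∀ {k} → Fin k → Bool
∅ _ = false

infix 4 _⊆_
_⊆_ : ∀ {k} → (Fin k → Bool) → (Fin k → Bool) → Set
P ⊆ Q = ∀ i → P i ≡ true → Q i ≡ true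

⊕-⊆ : ∀ {k} {P Q R : Fin k → Bool} → P ⊆ R → Q ⊆ R → P ⊕ Q ⊆ R
⊕-⊆ {P = P} {Q} p q i r with xor-true {P i} {Q i} r
... | inj₁ (s , _) = p i s
... | inj₂ (_ , s) = q i s

eqB-⊆ : ∀ {k} {a : Fin k} {P : Fin k → Bool} → P a ≡ true → eqB a ⊆ P
eqB-⊆ {a = a} {P} p i q = subst (λ j → P j ≡ true) (eqB-true a i q) p

⊆-false : ∀ {k} {P Q : Fin k → Bool} → P ⊆ Q → ∀ {i} → Q i ≡ false → P i ≡ false
⊆-false sub {i} q = ≢true (λ p → true≢false (sub i p) q)

bool-ext : ∀ {a b} → (a ≡ true → b ≡ true) → (b ≡ true → a ≡ true) → a ≡ b
bool-ext {true} f g = sym (f refl)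
bool-ext {false} {true} f g = g refl
bool-ext {false} {false} f g = refl

eqB-sym : ∀ {k} (a b : Fin k) → eqB a b ≡ eqB b a
eqB-sym a b = bool-ext (λ p → subst (λ c → eqB c a ≡ true) (eqB-true a b p) (eqB-refl a))
  (λ p → subst (λ c → eqB c b ≡ true) (eqB-true b a p) (eqB-refl b))

-- Cycle space, joins and connectivity, seen through parities on cuts.

module Cuts (G : Graph) where

  V E : Set
  V = Fin (n G)
  E = Fin (m G)

  VS ES : Set
  VS = V → Bool
  ES = E → Bool

  δ : VS → ES
  δ S e = S (end₁ G e) xor S (end₂ G e)

  dot : ES → VS → Bool
  dot Q S = xsum (λ e → Q e ∧ δ S e)

  -- The cycle space as the orthogonal complement of the cuts. Testing all cuts instead of vertex
  -- degrees makes closure under `⊕` a matter of linearity of `dot`.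
  record Cycle (C : ES) : Set where
    constructor cycle
    field even-cut : ∀ S → dot C S ≡ false
  open Cycle public

  -- A path from `x` to `y` up to adding cycles: it crosses a cut oddly exactly when the cut
  -- separates its ends.
  record Join (Q : ES) (x y : V) : Set where
    constructor join
    field cut : ∀ S → dot Q S ≡ S x xor S y
  open Join public

  Closed : ES → VS → Set
  Closed Q S = ∀ e → Q e ≡ true → δ S e ≡ false

  dot-cong : ∀ {P Q} → P ≗ Q → ∀ S → dot P S ≡ dot Q S
  dot-cong p S = xsum-cong (λ e → cong (_∧ δ S e) (p e))

  dot-⊕ : ∀ P Q S → dot (P ⊕ Q) S ≡ dot P S xor dot Q S
  dot-⊕ P Q S = trans (xsum-cong (λ e → ∧-distribʳ-xor (δ S e) (P e) (Q e))) (xsum-xor (λ e → P e ∧ δ S e) (λ e → Q e ∧ δ S e))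

  dot-eqB : ∀ f S → dot (eqB f) S ≡ δ S f
  dot-eqB f S = xsum-eqB f (δ S)

  δ-⊕ : ∀ S S′ e → δ (S ⊕ S′) e ≡ δ S e xor δ S′ e
  δ-⊕ S S′ e = xor-interchange (S (end₁ G e)) (S′ (end₁ G e)) (S (end₂ G e)) (S′ (end₂ G e))

  δ-cong : ∀ {S S′} → S ≗ S′ → ∀ e → δ S e ≡ δ S′ e
  δ-cong p e = cong₂ _xor_ (p _) (p _)

  dot-congʳ : ∀ Q {S S′} → S ≗ S′ → dot Q S ≡ dot Q S′
  dot-congʳ Q p = xsum-cong (λ e → cong (Q e ∧_) (δ-cong p e))

  dot-⊕ʳ : ∀ Q S S′ → dot Q (S ⊕ S′) ≡ dot Q S xor dot Q S′
  dot-⊕ʳ Q S S′ = trans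
    (xsum-cong (λ e → trans (cong (Q e ∧_) (δ-⊕ S S′ e)) (∧-distribˡ-xor (Q e) (δ S e) (δ S′ e))))
    (xsum-xor (λ e → Q e ∧ δ S e) (λ e → Q e ∧ δ S′ e))

  dot-closed : ∀ Q S → (∀ e → Q e ≡ true → δ S e ≡ false) → dot Q S ≡ false
  dot-closed Q S c = xsum-false λ e → ≢true λ p → true≢false (proj₂ (∧-true p)) (c e (proj₁ (∧-true p)))

  Join-∅ : ∀ x → Join ∅ x x
  Join-∅ x = join λ S → trans (xsum-false {m G} (λ _ → refl)) (sym (xor-same (S x)))

  Join-edge : ∀ f → Join (eqB f) (end₁ G f) (end₂ G f)
  Join-edge f = join (dot-eqB f)

  Join-sym : ∀ {Q x y} → Join Q x y → Join Q y x
  Join-sym {x = x} {y} j = join λ S → trans (cut j S) (xor-comm (S x) (S y))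

  xor-cancel : ∀ a b c → (a xor b) xor (b xor c) ≡ a xor c
  xor-cancel true true c = refl
  xor-cancel true false c = refl
  xor-cancel false true true = refl
  xor-cancel false true false = refl
  xor-cancel false false c = refl

  Join-trans : ∀ {P Q x y z} → Join P x y → Join Q y z → Join (P ⊕ Q) x z
  Join-trans {P} {Q} {x} {y} {z} p q = join λ S →
    trans (dot-⊕ P Q S) (trans (cong₂ _xor_ (cut p S) (cut q S)) (xor-cancel (S x) (S y) (S z)))

  Join-cong : ∀ {P Q x y} → P ≗ Q → Join P x y → Join Q x y
  Join-cong e j = join λ S → trans (dot-cong (λ i → sym (e i)) S) (cut j S)

  Join-loop : ∀ {Q x} → Join Q x x → Cycle Q
  Join-loop {x = x} j = cycle λ S → trans (cut j S) (xor-same (S x))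

  Join-cycle : ∀ {P C x y} → Join P x y → Cycle C → Join (P ⊕ C) x y
  Join-cycle {P} {C} j c = join λ S →
    trans (dot-⊕ P C S) (trans (cong₂ _xor_ (cut j S) (even-cut c S)) (xor-identityʳ _))

  Cycle-⊕ : ∀ {P Q} → Cycle P → Cycle Q → Cycle (P ⊕ Q)
  Cycle-⊕ {P} {Q} p q = cycle λ S → trans (dot-⊕ P Q S) (cong₂ _xor_ (even-cut p S) (even-cut q S))

  Cycle-∅ : Cycle ∅
  Cycle-∅ = cycle λ S → xsum-false {m G} (λ _ → refl)

  Cycle-cong : ∀ {P Q} → P ≗ Q → Cycle P → Cycle Q
  Cycle-cong e c = cycle λ S → trans (dot-cong (λ i → sym (e i)) S) (even-cut c S)

  Join-closed : ∀ {z x y} S → Join z x y → (∀ e → z e ≡ true → δ S e ≡ false) → S x ≡ S y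
  Join-closed {z} S j c = xor-false (trans (sym (cut j S)) (dot-closed z S c))

  cycle? : ∀ C → Dec (Cycle C)
  cycle? C = map′ cycle even-cut
    (all-fun? (λ e p → trans (sym (dot-congʳ C e)) p) (λ S → dot C S Bool.≟ false))

  join? : ∀ Q x y → Dec (Join Q x y)
  join? Q x y = map′ join cut
    (all-fun? (λ e p → trans (sym (dot-congʳ Q e)) (trans p (cong₂ _xor_ (e x) (e y))))
      (λ S → dot Q S Bool.≟ (S x xor S y)))

  -- reachF follows the edges with F e = false.

  module Reach (F : ES) where

    R : ℕ → V → VS
    R = reachF G F

    reach-edge : ∀ k u g x → F g ≡ false →
      (R k u (end₁ G g) ≡ true × end₂ G g ≡ x) ⊎ (R k u (end₂ G g) ≡ true × end₁ G g ≡ x) →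
      R (suc k) u x ≡ true
    reach-edge k u g x fg r = ∨-trueʳ (R k u x) (anyFin-intro _ g (lemma r))
      where
      lemma : (R k u (end₁ G g) ≡ true × end₂ G g ≡ x) ⊎ (R k u (end₂ G g) ≡ true × end₁ G g ≡ x) →
        (not (F g) ∧ ((R k u (end₁ G g) ∧ eqB (end₂ G g) x) ∨ (R k u (end₂ G g) ∧ eqB (end₁ G g) x))) ≡ true
      lemma (inj₁ (p , refl)) rewrite fg | p | eqB-refl (end₂ G g) = refl
      lemma (inj₂ (p , refl)) rewrite fg | p | eqB-refl (end₁ G g) = ∨-trueʳ _ refl

    reach-inv : ∀ k u x → R (suc k) u x ≡ true → R k u x ≡ true ⊎
      (∃[ g ] F g ≡ false × ((R k u (end₁ G g) ≡ true × end₂ G g ≡ x) ⊎ (R k u (end₂ G g) ≡ true × end₁ G g ≡ x)))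
    reach-inv k u x r with ∨-true {R k u x} r
    ... | inj₁ p = inj₁ p
    ... | inj₂ p with anyFin-true _ p
    ...   | g , q with ∧-true {not (F g)} q
    ...     | fg , s with ∨-true s
    ...       | inj₁ t = inj₂ (g , not-true fg , inj₁ (proj₁ (∧-true t) , eqB-true _ _ (proj₂ (∧-true {R k u (end₁ G g)} t))))
    ...       | inj₂ t = inj₂ (g , not-true fg , inj₂ (proj₁ (∧-true t) , eqB-true _ _ (proj₂ (∧-true {R k u (end₂ G g)} t))))

    reach-join : ∀ k u x → R k u x ≡ true → Σ ES λ z → (∀ e → z e ≡ true → F e ≡ false) × Join z u x
    reach-join zero u x r with eqB-true u x r
    ... | refl = ∅ , (λ _ ()) , Join-∅ u
    reach-join (suc k) u x r with reach-inv k u x r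
    ... | inj₁ p = reach-join k u x p
    ... | inj₂ (g , fg , inj₁ (p , refl)) with reach-join k u (end₁ G g) p
    ...   | z , zF , j = z ⊕ eqB g , avail , Join-trans j (Join-edge g)
      where
      avail : ∀ e → (z ⊕ eqB g) e ≡ true → F e ≡ false
      avail e q with xor-true {z e} q
      ... | inj₁ (s , _) = zF e s
      ... | inj₂ (_ , s) = subst (λ e → F e ≡ false) (eqB-true g e s) fg
    reach-join (suc k) u x r | inj₂ (g , fg , inj₂ (p , refl)) with reach-join k u (end₂ G g) p
    ...   | z , zF , j = z ⊕ eqB g , avail , Join-trans j (Join-sym (Join-edge g))
      where
      avail : ∀ e → (z ⊕ eqB g) e ≡ true → F e ≡ false
      avail e q with xor-true {z e} q
      ... | inj₁ (s , _) = zF e s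
      ... | inj₂ (_ , s) = subst (λ e → F e ≡ false) (eqB-true g e s) fg

    Stable : ℕ → V → Set
    Stable k u = ∀ g → F g ≡ false → δ (R k u) g ≡ false

    stable-step : ∀ k u → Stable k u → R (suc k) u ≗ R k u
    stable-step k u st x = bool-ext to (∨-trueˡ _)
      where
      to : R (suc k) u x ≡ true → R k u x ≡ true
      to r with reach-inv k u x r
      ... | inj₁ p = p
      ... | inj₂ (g , fg , inj₁ (p , refl)) = trans (sym (xor-false (st g fg))) p
      ... | inj₂ (g , fg , inj₂ (p , refl)) = trans (xor-false (st g fg)) p

    -- A step that is not yet stable gains a vertex, so by pigeonhole `n G` steps exhaust the
    -- component.
    stable-or-grows : ∀ k u → Stable k u ⊎ (suc k ≤ count (R k u))
    stable-or-grows zero u = inj₂ (≤-reflexive (sym (count-eqB u)))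
    stable-or-grows (suc k) u with all? (λ g → (F g Bool.≟ false) →-dec (δ (R k u) g Bool.≟ false))
    ... | yes st = inj₁ (λ g fg → trans (δ-cong (stable-step k u st) g) (st g fg))
    ... | no ¬st with stable-or-grows k u
    ...   | inj₁ st = contradiction st ¬st
    ...   | inj₂ big with ¬∀⟶∃¬ _ _ (λ g → (F g Bool.≟ false) →-dec (δ (R k u) g Bool.≟ false)) ¬st
    ...     | g , ng = inj₂ (≤-trans (s≤s big) (strict (xor-true crossing)))
      where
      fg : F g ≡ false
      fg = ≢true (λ t → ng (λ f → ⊥-elim (true≢false t f)))
      crossing : δ (R k u) g ≡ true
      crossing with bool-cases (δ (R k u) g)
      ... | inj₁ t = t
      ... | inj₂ f = contradiction (λ _ → f) ng
      strict : _ → suc (count (R k u)) ≤ count (R (suc k) u)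
      strict (inj₁ (p , q)) = count-strict (λ i → ∨-trueˡ _) (end₂ G g) q (reach-edge k u g _ fg (inj₁ (p , refl)))
      strict (inj₂ (p , q)) = count-strict (λ i → ∨-trueˡ _) (end₁ G g) p (reach-edge k u g _ fg (inj₂ (q , refl)))

    reach-stable : ∀ u → Stable (n G) u
    reach-stable u with stable-or-grows (n G) u
    ... | inj₁ st = st
    ... | inj₂ big = contradiction (≤-trans big (count≤ (R (n G) u))) 1+n≰n

    reach-refl : ∀ k u → R k u u ≡ true
    reach-refl zero u = eqB-refl u
    reach-refl (suc k) u = ∨-trueˡ _ (reach-refl k u)

    reach-closed : ∀ S → (∀ e → F e ≡ false → δ S e ≡ false) → ∀ k u x → R k u x ≡ true → S u ≡ S x
    reach-closed S c k u x r with reach-join k u x r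
    ... | z , zF , j = Join-closed S j (λ e q → c e (zF e q))

  reachF-cong : ∀ {F F′} → F ≗ F′ → ∀ k u x → reachF G F k u x ≡ reachF G F′ k u x
  reachF-cong p zero u x = refl
  reachF-cong p (suc k) u x = cong₂ _∨_ (reachF-cong p k u x) (anyFin-cong λ g →
    cong₂ _∧_ (cong not (p g)) (cong₂ _∨_ (cong (_∧ _) (reachF-cong p k u _)) (cong (_∧ _) (reachF-cong p k u _))))

  conn : ES → V → VS
  conn Q = reachF G (not ∘ Q) (n G)

  module _ (Q : ES) where
    open Reach (not ∘ Q)

    conn-refl : ∀ u → conn Q u u ≡ true
    conn-refl = reach-refl (n G)

    conn-Closed : ∀ u → Closed Q (conn Q u)
    conn-Closed u e q = reach-stable u e (cong not q)

    conn-join : ∀ u x → conn Q u x ≡ true → Σ ES λ z → z ⊆ Q × Join z u x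
    conn-join u x r with reach-join (n G) u x r
    ... | z , zF , j = z , (λ e q → not-false (zF e q)) , j

    conn-least : ∀ S → Closed Q S → ∀ {u x} → conn Q u x ≡ true → S u ≡ S x
    conn-least S c = reach-closed S (λ e f → c e (not-false f)) (n G) _ _

    conn-sym : ∀ {u x} → conn Q u x ≡ true → conn Q x u ≡ true
    conn-sym {u} {x} r = trans (conn-least (conn Q x) (conn-Closed x) r) (conn-refl x)

    conn-trans : ∀ {u v x} → conn Q u v ≡ true → conn Q v x ≡ true → conn Q u x ≡ true
    conn-trans {u} r s = trans (sym (conn-least (conn Q u) (conn-Closed u) s)) r

  conn-mono : ∀ {P Q} → P ⊆ Q → ∀ {u x} → conn P u x ≡ true → conn Q u x ≡ true
  conn-mono {P} {Q} sub {u} r = trans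
    (sym (conn-least P (conn Q u) (λ e p → conn-Closed Q u e (sub e p)) r)) (conn-refl Q u)

-- Weights of edge sets under symmetric difference.

mask : ∀ {k} → (Fin k → ℕ) → (Fin k → Bool) → Fin k → ℕ
mask w Q e = if Q e then w e else 0

wt : ∀ {k} → (Fin k → ℕ) → (Fin k → Bool) → ℕ
wt w Q = sumℕ (mask w Q)

module _ {k} (w : Fin k → ℕ) where

  wt-cong : ∀ {P Q} → P ≗ Q → wt w P ≡ wt w Q
  wt-cong p = sum-cong (λ e → cong (λ b → if b then w e else 0) (p e))

  wt-disjoint : ∀ {P Q} → (∀ e → P e ≡ true → Q e ≡ false ⊎ w e ≡ 0) →
    wt w (P ⊕ Q) ≡ wt w P + wt w Q
  wt-disjoint {P} {Q} d = trans (sum-cong pointwise) (sum-+ (mask w P) (mask w Q))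
    where
    pointwise : ∀ e → (if P e xor Q e then w e else 0) ≡ (if P e then w e else 0) + (if Q e then w e else 0)
    pointwise e with P e | Q e | d e
    ... | false | _ | _ = refl
    ... | true | false | _ = sym (+-identityʳ _)
    ... | true | true | f with f refl
    ...   | inj₂ z rewrite z = refl

  -- Containment is needed only on edges of nonzero weight. With the weight `cross S` it is needed
  -- only along the cut of `S`.
  wt-remove : ∀ {K P} → (∀ e → P e ≡ true → K e ≡ true ⊎ w e ≡ 0) →
    wt w (K ⊕ P) + wt w P ≡ wt w K
  wt-remove {K} {P} d = trans (sym (sum-+ (mask w (K ⊕ P)) (mask w P))) (sum-cong pointwise)
    where
    pointwise : ∀ e → (if K e xor P e then w e else 0) + (if P e then w e else 0) ≡ (if K e then w e else 0)
    pointwise e with P e | K e | d e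
    ... | false | false | _ = refl
    ... | false | true | _ = +-identityʳ _
    ... | true | true | _ = refl
    ... | true | false | f with f refl
    ...   | inj₂ z rewrite z = refl

  wt-null : ∀ {K z} → (∀ e → z e ≡ true → w e ≡ 0) → wt w (K ⊕ z) ≡ wt w K
  wt-null {K} {z} d = sum-cong pointwise
    where
    pointwise : ∀ e → (if K e xor z e then w e else 0) ≡ (if K e then w e else 0)
    pointwise e with z e | K e | d e
    ... | false | false | _ = refl
    ... | false | true | _ = refl
    ... | true | true | f = sym (f refl)
    ... | true | false | f = f refl

  -- On `P` the two sets on the left agree with `K ⊕ Q` and `K`, off `P` with `K` and `K ⊕ Q`. Thus
  -- two sets that swap a part of their difference keep their total weight.
  wt-exchange : ∀ K {P Q} → P ⊆ Q →
    wt w (K ⊕ P) + wt w ((K ⊕ P) ⊕ Q) ≡ wt w (K ⊕ Q) + wt w K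
  wt-exchange K {P} {Q} d = trans (sym (sum-+ (mask w (K ⊕ P)) (mask w ((K ⊕ P) ⊕ Q))))
    (trans (sum-cong pointwise) (sum-+ (mask w (K ⊕ Q)) (mask w K)))
    where
    pointwise : ∀ e →
      (if K e xor P e then w e else 0) + (if (K e xor P e) xor Q e then w e else 0) ≡
      (if K e xor Q e then w e else 0) + (if K e then w e else 0)
    pointwise e with P e | Q e | K e | d e
    ... | false | q | true | _ = +-comm (w e) _
    ... | false | q | false | _ = +-comm 0 (if q then w e else 0)
    ... | true | true | true | _ = refl
    ... | true | true | false | _ = refl
    ... | true | false | _ | f with f refl
    ...   | ()

  wt-eqB : ∀ f → wt w (eqB f) ≡ w f
  wt-eqB = go w
    where
    go : ∀ {k} (w : Fin k → ℕ) f → wt w (eqB f) ≡ w f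
    go {suc k} w zero = trans (cong (w zero +_) (sum-0 k)) (+-identityʳ _)
    go w (suc f) = go (λ e → w (suc e)) f

  par-wt : ∀ P Q → par (wt w (P ⊕ Q)) ≡ par (wt w P) xor par (wt w Q)
  par-wt P Q = trans (par-sum (mask w (P ⊕ Q))) (trans (xsum-cong pointwise)
    (trans (xsum-xor (par ∘ mask w P) (par ∘ mask w Q))
      (sym (cong₂ _xor_ (par-sum (mask w P)) (par-sum (mask w Q))))))
    where
    par-sum : ∀ {k} (f : Fin k → ℕ) → par (sumℕ f) ≡ xsum (par ∘ f)
    par-sum {zero} f = refl
    par-sum {suc k} f = trans (par-+ (f zero) _) (cong (par (f zero) xor_) (par-sum (λ i → f (suc i))))
    pointwise : ∀ e → par (if P e xor Q e then w e else 0) ≡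
      par (if P e then w e else 0) xor par (if Q e then w e else 0)
    pointwise e with P e | Q e
    ... | false | _ = refl
    ... | true | false = sym (xor-identityʳ _)
    ... | true | true = sym (xor-same (par (w e)))

  wt-witness : ∀ Q → 0 < wt w Q → ∃[ e ] Q e ≡ true × 0 < w e
  wt-witness Q p with sum-pos _ p
  ... | e , q = e , split (Q e) refl q
    where
    split : ∀ b → Q e ≡ b → 0 < (if b then w e else 0) → Q e ≡ true × 0 < w e
    split true t r = t , r

  wt-term : ∀ Q e → Q e ≡ true → w e ≤ wt w Q
  wt-term Q e q = subst (_≤ wt w Q) (cong (λ b → if b then w e else 0) q) (term≤sum (λ e → if Q e then w e else 0) e)

par-gap : ∀ a b → par a ≡ par b → suc a ≤ b → suc (suc a) ≤ b
par-gap a b p le with m≤n⇒m<n∨m≡n le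
... | inj₁ lt = lt
... | inj₂ refl = contradiction p (λ q → not≢ (par a) q)
  where
  not≢ : ∀ c → c ≢ not c
  not≢ true ()
  not≢ false ()

-- Crossings of a cut, and the first entry of a path into a vertex set.

module Weights (G : Graph) where
  open Cuts G

  cross : VS → E → ℕ
  cross S e = b2n (δ S e)

  wt-cross : ∀ S Q → wt (cross S) Q ≡ count (λ e → Q e ∧ δ S e)
  wt-cross S Q = sum-cong pointwise
    where
    pointwise : ∀ e → (if Q e then b2n (δ S e) else 0) ≡ b2n (Q e ∧ δ S e)
    pointwise e with Q e
    ... | true = refl
    ... | false = refl

  par-cross : ∀ S Q → par (wt (cross S) Q) ≡ dot Q S
  par-cross S Q = trans (cong par (wt-cross S Q)) (par-count (λ e → Q e ∧ δ S e))

  crossing-ends : ∀ S f → δ S f ≡ true → ∃[ a ] ∃[ b ] S a ≡ true × S b ≡ false × Join (eqB f) a b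
  crossing-ends S f p with xor-true {S (end₁ G f)} p
  ... | inj₁ (a , b) = _ , _ , a , b , Join-edge f
  ... | inj₂ (b , a) = _ , _ , a , b , Join-sym (Join-edge f)

  -- By the parity hypothesis the Q-component of b reaches S; P is a Q-path stopped at its first vertex in S.
  first-hit : ∀ Q S b → S b ≡ false →
    (∀ R → R b ≡ true → (∀ v → S v ≡ true → R v ≡ false) → dot Q R ≡ true) →
    Σ ES λ P → ∃[ a ] P ⊆ Q × Join P b a × S a ≡ true × wt (cross S) P ≡ 1
  first-hit Q S b Sb odd = finish (xsum-witness _ (odd R Rb disjoint))
    where
    outside : ES
    outside e = Q e ∧ (not (S (end₁ G e)) ∧ not (S (end₂ G e)))
    R : VS
    R = conn outside b
    Rb : R b ≡ true
    Rb = conn-refl outside b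
    S-closed : Closed outside S
    S-closed e o with ∧-true {Q e} o
    ... | _ , q with ∧-true {not (S (end₁ G e))} q
    ...   | s , t = cong₂ _xor_ (not-true s) (not-true t)
    R-outside : ∀ v → R v ≡ true → S v ≡ false
    R-outside v r = trans (sym (conn-least outside S S-closed r)) Sb
    disjoint : ∀ v → S v ≡ true → R v ≡ false
    disjoint v s = ≢true (λ r → true≢false s (R-outside v r))
    finish : (∃[ f ] Q f ∧ δ R f ≡ true) → Σ ES λ P → ∃[ a ] P ⊆ Q × Join P b a × S a ≡ true × wt (cross S) P ≡ 1
    finish (f , q) with crossing-ends R f (proj₂ (∧-true {Q f} q))
    ... | b′ , a′ , Rb′ , Ra′ , jf with conn-join outside b b′ Rb′
    ...   | z , z⊆ , jz = z ⊕ eqB f , a′ , ⊕-⊆ z⊆Q (eqB-⊆ Qf) , Join-trans jz jf , Sa′ , one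
      where
      Qf : Q f ≡ true
      Qf = proj₁ (∧-true {Q f} q)
      z⊆Q : z ⊆ Q
      z⊆Q e p = proj₁ (∧-true {Q e} (z⊆ e p))
      -- If `f` did not cross `S`, it would be an edge of `outside` and could not leave the
      -- component `R`.
      δSf : δ S f ≡ true
      δSf with bool-cases (δ S f)
      ... | inj₁ t = t
      ... | inj₂ no-cross = ⊥-elim (true≢false (proj₂ (∧-true {Q f} q)) (conn-Closed outside b f out))
        where
        same : S b′ ≡ S a′
        same = xor-false (trans (sym (cut jf S)) (trans (dot-eqB f S) no-cross))
        both : ∀ s t → s xor t ≡ false → (s ≡ false) ⊎ (t ≡ false) → not s ∧ not t ≡ true
        both false false _ _ = refl
        both true true _ (inj₁ ())
        both true true _ (inj₂ ())
        one-out : (S (end₁ G f) ≡ false) ⊎ (S (end₂ G f) ≡ false)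
        one-out with xor-true {R (end₁ G f)} (proj₂ (∧-true {Q f} q))
        ... | inj₁ (r , _) = inj₁ (R-outside _ r)
        ... | inj₂ (_ , r) = inj₂ (R-outside _ r)
        out : outside f ≡ true
        out = cong₂ _∧_ Qf (both _ _ no-cross one-out)
      Sa′ : S a′ ≡ true
      Sa′ = trans (cong (_xor S a′) (sym (R-outside b′ Rb′))) (trans (sym (cut jf S)) (trans (dot-eqB f S) δSf))
      one : wt (cross S) (z ⊕ eqB f) ≡ 1
      one = trans (wt-cong (cross S) (λ e → xor-comm (z e) (eqB f e)))
        (trans (wt-null (cross S) (λ e p → cong b2n (S-closed e (z⊆ e p))))
        (trans (wt-eqB (cross S) f) (cong b2n δSf)))

-- Identities for rearranging symmetric differences and sums.

module XorIdentities where
  open xor-∧-Solver using (solve; _:+_; _:=_)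

  xor-share : ∀ a b c → (a xor b) xor (a xor c) ≡ b xor c
  xor-share = solve 3 (λ a b c → (a :+ b) :+ (a :+ c) := b :+ c) refl

  xor-absorb : ∀ a b → b ≡ a xor (a xor b)
  xor-absorb = solve 2 (λ a b → b := a :+ (a :+ b)) refl

  xor-absorbᵐ : ∀ a b → b xor (a xor b) ≡ a
  xor-absorbᵐ = solve 2 (λ a b → b :+ (a :+ b) := a) refl

  xor-absorbˡ : ∀ a b c → a xor (a xor (b xor c)) ≡ b xor c
  xor-absorbˡ = solve 3 (λ a b c → a :+ (a :+ (b :+ c)) := b :+ c) refl

  xor-shift : ∀ a b c → a xor (b xor c) ≡ (a xor c) xor b
  xor-shift = solve 3 (λ a b c → a :+ (b :+ c) := (a :+ c) :+ b) refl

  xor-swap : ∀ j k c → (j xor k) xor c ≡ k xor (j xor c)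
  xor-swap = solve 3 (λ j k c → (j :+ k) :+ c := k :+ (j :+ c)) refl

  xor-insert : ∀ j c p → p xor c ≡ j xor ((j xor c) xor p)
  xor-insert = solve 3 (λ j c p → p :+ c := j :+ ((j :+ c) :+ p)) refl

  xor-insert₄ : ∀ k k′ z c → k xor (z xor c) ≡ ((k′ xor c) xor (k xor k′)) xor z
  xor-insert₄ = solve 4 (λ k k′ z c → k :+ (z :+ c) := ((k′ :+ c) :+ (k :+ k′)) :+ z) refl

  xor-insert₅ : ∀ j k p z c → j xor ((j xor k) xor (p xor z)) ≡ (((j xor c) xor p) xor (k xor (j xor c))) xor z
  xor-insert₅ = solve 5 (λ j k p z c → j :+ ((j :+ k) :+ (p :+ z)) := ((((j :+ c) :+ p) :+ (k :+ (j :+ c)))) :+ z) refl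

open XorIdentities

module Rearrangements where
  open +-*-Solver using (solve; con; _:+_; _:=_)

  +-rearrange₂ : ∀ p q → p + (q + 2) ≡ q + (2 + p)
  +-rearrange₂ = solve 2 (λ p q → p :+ (q :+ con 2) := q :+ (con 2 :+ p)) refl

  +-rearrange₁ : ∀ p q r → p + (q + (r + 1)) ≡ 1 + ((p + r) + q)
  +-rearrange₁ = solve 3 (λ p q r → p :+ (q :+ (r :+ con 1)) := con 1 :+ ((p :+ r) :+ q)) refl

open Rearrangements

-- Minimum-weight T-joins and the cuts along which weights can be lowered.

module MinimumJoin (G : Graph) where
  open Cuts G
  open Weights G

  -- `T` stays implicit in `J`: the T-cuts are the cuts that `J` meets oddly, and the T-joins are
  -- the sets `J ⊕ C` with `C` a cycle.
  Odd3 : ES → Set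
  Odd3 J = ∀ S → dot J S ≡ true → 3 ≤ count (δ S)

  -- Sets that differ by a cycle then have weights of equal parity, so a strict inequality between
  -- them is worth 2.
  EvenOnCycles : (E → ℕ) → Set
  EvenOnCycles w = ∀ C → Cycle C → par (wt w C) ≡ false

  Minimum : (E → ℕ) → ES → Set
  Minimum w J = ∀ C → Cycle C → wt w J ≤ wt w (J ⊕ C)

  Near : ES → ES → V → V → Set
  Near J K x y = Join (J ⊕ K) x y

  -- Sets M differing from J by a path have a minimum weight, attained at M with
  -- ends x and y.  The zero-weight component S of y is a cut that M avoids and
  -- that J crosses exactly once; lowering w along it keeps J minimum.
  module TightCut (w : E → ℕ) (even : EvenOnCycles w) (J : ES) (min : Minimum w J) (pos : 0 < wt w J)
    (M : ES) (x y : V) (nearM : Near J M x y) (d-least : ∀ {K′ u v} → Near J K′ u v → wt w M ≤ wt w K′) where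

    near-add : ∀ {M z x a b} → Near J M x a → Join z a b → Near J (M ⊕ z) x b
    near-add {M} {z} j k = Join-cong (λ e → xor-assoc (J e) (M e) (z e)) (Join-trans j k)

    near-diff : ∀ {M K′ x y a} → Near J M x y → Near J K′ x a → Join (M ⊕ K′) y a
    near-diff {M} {K′} j k = Join-cong
      (λ e → xor-share (J e) (M e) (K′ e))
      (Join-trans (Join-sym j) k)

    d : ℕ
    d = wt w M

    -- Deleting one edge of positive weight from `J` already gives a competitor of `M`.
    d<J : suc d ≤ wt w J
    d<J with wt-witness w J pos
    ... | f , Jf , wf = <-≤-trans (s≤s (d-least near)) (begin
      suc (wt w (J ⊕ eqB f)) ≡⟨ +-comm 1 _ ⟩
      wt w (J ⊕ eqB f) + 1 ≤⟨ +-monoʳ-≤ (wt w (J ⊕ eqB f)) wf ⟩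
      wt w (J ⊕ eqB f) + w f ≡⟨ cong (wt w (J ⊕ eqB f) +_) (sym (wt-eqB w f)) ⟩
      wt w (J ⊕ eqB f) + wt w (eqB f) ≡⟨ wt-remove w (λ e p → inj₁ (eqB-⊆ {P = J} Jf e p)) ⟩
      wt w J ∎)
      where
      open ≤-Reasoning
      near : Near J (J ⊕ eqB f) (end₁ G f) (end₂ G f)
      near = Join-cong (λ e → xor-absorb (J e) (eqB f e)) (Join-edge f)

    Z : ES
    Z e = w e ℕ.≡ᵇ 0

    Z-zero : ∀ e → Z e ≡ true → w e ≡ 0
    Z-zero e = zero-test (w e)
      where
      zero-test : ∀ k → (k ℕ.≡ᵇ 0) ≡ true → k ≡ 0
      zero-test zero _ = refl

    S : VS
    S = conn Z y

    S-pos : ∀ {e} → δ S e ≡ true → 1 ≤ w e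
    S-pos {e} p = n≢0⇒n>0 (λ q → true≢false p (conn-Closed Z y e (cong (ℕ._≡ᵇ 0) q)))

    Sy : S y ≡ true
    Sy = conn-refl Z y

    zero-path : ∀ {a b} → S a ≡ true → S b ≡ true →
      Σ ES λ z → (∀ e → z e ≡ true → w e ≡ 0) × (∀ e → z e ≡ true → δ S e ≡ false) × Join z a b
    zero-path {a} {b} Sa Sb with conn-join Z a b (conn-trans Z (conn-sym Z Sa) Sb)
    ... | z , z⊆ , j = z , (λ e p → Z-zero e (z⊆ e p)) , (λ e p → conn-Closed Z y e (z⊆ e p)) , j

    -- Otherwise a weightless path from `y` back to `x` turns `M` into a T-join of weight `d`, less
    -- than the minimum.
    Sx : S x ≡ false
    Sx = ≢true λ Sx′ → let (z , z0 , _ , j) = zero-path Sy Sx′ in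
      <⇒≱ d<J (≤-trans (min _ (Join-loop (near-add nearM j))) (≤-reflexive (trans
        (wt-cong w (λ e → xor-absorbˡ (J e) (M e) (z e)))
        (wt-null w z0))))

    -- The free end `a` slides at no cost through `S` to an end of `f`; deleting `f` then saves its
    -- positive weight and leaves a competitor of `M`.
    drop : ∀ {K′ a f} → Near J K′ x a → S a ≡ true → K′ f ≡ true → δ S f ≡ true → suc d ≤ wt w K′
    drop {K′} {a} {f} near Sa K′f δf with crossing-ends S f δf
    ... | a₂ , b₂ , Sa₂ , _ , jf with zero-path Sa Sa₂
    ...   | z , z0 , _ , jz = begin
      suc d ≤⟨ s≤s (d-least (near-add near (Join-trans jz jf))) ⟩
      suc (wt w (K′ ⊕ (z ⊕ eqB f))) ≡⟨ cong suc (wt-cong w (λ e →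
         xor-shift (K′ e) (z e) (eqB f e))) ⟩
      suc (wt w ((K′ ⊕ eqB f) ⊕ z)) ≡⟨ cong suc (wt-null w z0) ⟩
      suc (wt w (K′ ⊕ eqB f)) ≡⟨ +-comm 1 _ ⟩
      wt w (K′ ⊕ eqB f) + 1 ≤⟨ +-monoʳ-≤ (wt w (K′ ⊕ eqB f)) (S-pos δf) ⟩
      wt w (K′ ⊕ eqB f) + w f ≡⟨ cong (wt w (K′ ⊕ eqB f) +_) (sym (wt-eqB w f)) ⟩
      wt w (K′ ⊕ eqB f) + wt w (eqB f) ≡⟨ wt-remove w (λ e p → inj₁ (eqB-⊆ {P = K′} K′f e p)) ⟩
      wt w K′ ∎
      where open ≤-Reasoning

    M-avoids : ∀ e → δ S e ≡ true → M e ≡ false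
    M-avoids e δe = ≢true λ Ke → 1+n≰n (drop nearM Sy Ke δe)

    cr : ES → ℕ
    cr = wt (cross S)

    cross-zero : ∀ {e} → δ S e ≡ false → cross S e ≡ 0
    cross-zero p = cong b2n p

    off-M : ∀ K′ e → (M ⊕ K′) e ≡ true → K′ e ≡ true ⊎ cross S e ≡ 0
    off-M K′ e p with bool-cases (δ S e)
    ... | inj₂ c = inj₂ (cross-zero c)
    ... | inj₁ c = inj₁ (trans (sym (cong (_xor K′ e) (M-avoids e c))) p)

    -- `D` joins two vertices of `S`, so having left `S` through `f` it must return. The resulting
    -- ear `C`, from `a₂` to `a₃`, is swapped between `K′` and `M`: `K₁` is `K′` without crossings
    -- of the ear, and `K₂` is `M ⊕ C`.
    module Uncross (K′ : ES) (a : V) (near : Near J K′ x a) (Sa : S a ≡ true) (f : E) (K′f : K′ f ≡ true)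
      (δf : δ S f ≡ true) (a₂ b₂ : V) (Sa₂ : S a₂ ≡ true) (jf : Join (eqB f) a₂ b₂) where

      D Q : ES
      D = M ⊕ K′
      Q = D ⊕ eqB f

      jD : Join D y a
      jD = near-diff nearM near

      Df : D f ≡ true
      Df = cong₂ _xor_ (M-avoids f δf) K′f

      Qf : Q f ≡ false
      Qf = cong₂ _xor_ Df (eqB-refl f)

      odd : ∀ R → R b₂ ≡ true → (∀ v → S v ≡ true → R v ≡ false) → dot Q R ≡ true
      odd R Rb dis = trans (dot-⊕ D (eqB f) R) (cong₂ _xor_
        (trans (cut jD R) (cong₂ _xor_ (dis y Sy) (dis a Sa)))
        (trans (cut jf R) (cong₂ _xor_ (dis a₂ Sa₂) Rb)))

      module _ (P : ES) (a₃ : V) (P⊆Q : P ⊆ Q) (jP : Join P b₂ a₃) (Sa₃ : S a₃ ≡ true) (crP : cr P ≡ 1) where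

        C K₁ K₂ : ES
        C = eqB f ⊕ P
        K₁ = K′ ⊕ C
        K₂ = K₁ ⊕ D

        C⊆D : C ⊆ D
        C⊆D = ⊕-⊆ (eqB-⊆ {P = D} Df) (λ e p → ⊕-⊆ {P = D} (λ _ q → q) (eqB-⊆ {P = D} Df) e (P⊆Q e p))

        jC : Join C a₂ a₃
        jC = Join-trans jf jP

        Pf : P f ≡ false
        Pf = ⊆-false P⊆Q Qf

        disj : ∀ e → eqB f e ≡ true → P e ≡ false ⊎ cross S e ≡ 0
        disj e p = inj₁ (subst (λ g → P g ≡ false) (eqB-true f e p) Pf)

        crC : cr C ≡ 2
        crC = trans (wt-disjoint (cross S) disj) (cong₂ _+_ (trans (wt-eqB (cross S) f) (cong b2n δf)) crP)

        cr-K₁ : cr K₁ + 2 ≡ cr K′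
        cr-K₁ = trans (cong (cr K₁ +_) (sym crC)) (wt-remove (cross S) (λ e p → off-M K′ e (C⊆D e p)))

        -- `z`, the ear and `z′` close up to a cycle, which has even weight; `z′` contributes
        -- nothing.
        even-part : ∀ {z z′} → Join z y a₂ → Join z′ a₃ y → (∀ e → z′ e ≡ true → w e ≡ 0) →
          par (wt w (z ⊕ C)) ≡ false
        even-part {z} jz jz′ z0 = trans (cong par (sym (wt-null w {z ⊕ C} z0)))
          (even _ (Join-loop (Join-trans (Join-trans jz jC) jz′)))

        -- Up to the weightless `z`, `K₂` is a competitor of `M` that uses the crossing edge `f`. So
        -- it costs more than `d` by `drop`, and by parity at least 2 more.
        K₂-cost : ∀ {z} → Join z y a₂ → (∀ e → z e ≡ true → w e ≡ 0) → z f ≡ false →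
          par (wt w (z ⊕ C)) ≡ false → 2 + d ≤ wt w K₂
        K₂-cost {z} jz z0 zf ev = subst (2 + d ≤_) wt₂ (par-gap d _ parity (drop near₂ Sa₃ K₂zf δf))
          where
          K₂z : ES
          K₂z = M ⊕ (z ⊕ C)
          near₂ : Near J K₂z x a₃
          near₂ = near-add nearM (Join-trans jz jC)
          wt₂ : wt w K₂z ≡ wt w K₂
          wt₂ = trans (wt-cong w (λ e → xor-insert₄ (M e) (K′ e) (z e) (C e))) (wt-null w z0)
          K₂zf : K₂z f ≡ true
          K₂zf = cong₂ _xor_ (M-avoids f δf) (cong₂ _xor_ zf (cong₂ _xor_ (eqB-refl f) Pf))
          parity : par d ≡ par (wt w K₂z)
          parity = sym (trans (par-wt w M (z ⊕ C)) (trans (cong (par d xor_) ev) (xor-identityʳ _)))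

        -- The swap keeps the total weight, so what `M` gains is lost by `K′`.
        K₁-wt : 2 + d ≤ wt w K₂ → wt w K₁ + 2 ≤ wt w K′
        K₁-wt le = +-cancelˡ-≤ d _ _ (begin
          d + (wt w K₁ + 2) ≡⟨ +-rearrange₂ d (wt w K₁) ⟩
          wt w K₁ + (2 + d) ≤⟨ +-monoʳ-≤ (wt w K₁) le ⟩
          wt w K₁ + wt w K₂ ≡⟨ wt-exchange w K′ C⊆D ⟩
          wt w (K′ ⊕ D) + wt w K′ ≡⟨ cong (_+ wt w K′) (wt-cong w (λ e → xor-absorbᵐ (M e) (K′ e))) ⟩
          d + wt w K′ ∎)
          where open ≤-Reasoning

        uncrossed : ∀ {z} → Join z a a₂ → (∀ e → z e ≡ true → w e ≡ 0) → (∀ e → z e ≡ true → δ S e ≡ false) →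
          wt w K₁ + 2 ≤ wt w K′ →
          Σ ES λ K″ → ∃[ a″ ] Near J K″ x a″ × S a″ ≡ true × cr K″ + 2 ≡ cr K′ × wt w K″ + 2 ≤ wt w K′
        uncrossed {z} jz z0 zδ le = K′ ⊕ (z ⊕ C) , a₃ , near-add near (Join-trans jz jC) , Sa₃ ,
          trans (cong (_+ 2) (trans (wt-cong (cross S) eq) (wt-null (cross S) (λ e p → cross-zero (zδ e p))))) cr-K₁ ,
          ≤-trans (≤-reflexive (cong (_+ 2) (trans (wt-cong w eq) (wt-null w z0)))) le
          where
          eq : K′ ⊕ (z ⊕ C) ≗ K₁ ⊕ z
          eq e = xor-shift (K′ e) (z e) (C e)

    uncross : ∀ K′ a → Near J K′ x a → S a ≡ true → 0 < cr K′ →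
      Σ ES λ K″ → ∃[ a″ ] Near J K″ x a″ × S a″ ≡ true × cr K″ + 2 ≡ cr K′ × wt w K″ + 2 ≤ wt w K′
    uncross K′ a near Sa p =
      let (f , K′f , cf) = wt-witness (cross S) K′ p
          δf = b2n-true cf
          (a₂ , b₂ , Sa₂ , Sb₂ , jf) = crossing-ends S f δf
          module U = Uncross K′ a near Sa f K′f δf a₂ b₂ Sa₂ jf
          (P , a₃ , P⊆Q , jP , Sa₃ , crP) = first-hit U.Q S b₂ Sb₂ U.odd
          (z₁ , z₁0 , z₁δ , j₁) = zero-path Sa Sa₂
          (z₂ , z₂0 , z₂δ , j₂) = zero-path Sy Sa₂
          (z₃ , z₃0 , _ , j₃) = zero-path Sa₃ Sy
          z₂f = ≢true (λ q → true≢false δf (z₂δ f q))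
      in U.uncrossed P a₃ P⊆Q jP Sa₃ crP j₁ z₁0 z₁δ (U.K₁-wt P a₃ P⊆Q jP Sa₃ crP
           (U.K₂-cost P a₃ P⊆Q jP Sa₃ crP j₂ z₂0 z₂f (U.even-part P a₃ P⊆Q jP Sa₃ crP j₂ j₃ z₃0)))
      where
      b2n-true : ∀ {b} → 0 < b2n b → b ≡ true
      b2n-true {true} _ = refl

    -- Each uncrossing removes two crossings and at least two units of weight; once no crossing is
    -- left, at least `d` remains.
    crossing-cost : ∀ fuel K′ a → Near J K′ x a → S a ≡ true → cr K′ ≤ fuel → d + cr K′ ≤ wt w K′
    crossing-cost fuel K′ a near Sa le = cases fuel le (cr K′) refl
      where
      cases : ∀ fuel → cr K′ ≤ fuel → ∀ c → cr K′ ≡ c → d + cr K′ ≤ wt w K′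
      cases _ _ zero eq = ≤-trans (≤-reflexive (trans (cong (d +_) eq) (+-identityʳ d))) (d-least near)
      cases zero le (suc c) eq = contradiction (trans (sym eq) (n≤0⇒n≡0 le)) λ ()
      cases (suc fuel) le (suc c) eq =
        let (K″ , a″ , near″ , Sa″ , cr″ , wt″) = uncross K′ a near Sa (subst (0 <_) (sym eq) (s≤s z≤n))
            smaller = s≤s⁻¹ (≤-trans (≤-trans (n≤1+n _) (≤-reflexive (trans (+-comm 2 _) cr″))) le)
        in begin
          d + cr K′ ≡⟨ cong (d +_) (sym cr″) ⟩
          d + (cr K″ + 2) ≡⟨ sym (+-assoc d (cr K″) 2) ⟩
          (d + cr K″) + 2 ≤⟨ +-monoˡ-≤ 2 (crossing-cost fuel K″ a″ near″ Sa″ smaller) ⟩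
          wt w K″ + 2 ≤⟨ wt″ ⟩
          wt w K′ ∎
        where open ≤-Reasoning

    module _ (C : ES) (cyc : Cycle C) where

      J′ : ES
      J′ = J ⊕ C

      jMJ : Join (M ⊕ J′) x y
      jMJ = Join-cong (λ e → xor-swap (J e) (M e) (C e)) (Join-cycle nearM cyc)

      odd-J′ : ∀ R → R x ≡ true → (∀ v → S v ≡ true → R v ≡ false) → dot (M ⊕ J′) R ≡ true
      odd-J′ R Rx dis = trans (cut jMJ R) (cong₂ _xor_ Rx (dis y Sy))

      module _ (P : ES) (a : V) (P⊆ : P ⊆ M ⊕ J′) (jP : Join P x a) (Sa : S a ≡ true) (crP : cr P ≡ 1) where

        K′ J″ : ES
        K′ = J′ ⊕ P
        J″ = K′ ⊕ (M ⊕ J′)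

        near-K′ : Near J K′ x a
        near-K′ = Join-cong (λ e → xor-insert (J e) (C e) (P e)) (Join-cycle jP cyc)

        cr-K′ : cr K′ + 1 ≡ cr J′
        cr-K′ = trans (cong (cr K′ +_) (sym crP)) (wt-remove (cross S) (λ e p → off-M J′ e (P⊆ e p)))

        min-J″ : ∀ {z} → Join z a y → (∀ e → z e ≡ true → w e ≡ 0) → wt w J ≤ wt w J″
        min-J″ {z} jz z0 = ≤-trans (min _ (Join-loop (Join-trans (Join-sym nearM) (Join-trans jP jz))))
          (≤-reflexive (trans (wt-cong w (λ e → xor-insert₅ (J e) (M e) (P e) (z e) (C e))) (wt-null w z0)))

        -- `M` and `J′` swap the path `P` from `x` to `S`. One result, `K′`, ends in `S` and pays
        -- for its crossings; the other, `J″`, is a T-join up to a weightless path. The 1 on the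
        -- right is the single crossing of `P`.
        bound : wt w J ≤ wt w J″ → wt w J + cr J′ ≤ suc (wt w J′)
        bound le = +-cancelˡ-≤ d _ _ (begin
          d + (wt w J + cr J′) ≡⟨ cong (λ c → d + (wt w J + c)) (sym cr-K′) ⟩
          d + (wt w J + (cr K′ + 1)) ≡⟨ +-rearrange₁ d (wt w J) (cr K′) ⟩
          suc ((d + cr K′) + wt w J) ≤⟨ s≤s (+-mono-≤ (crossing-cost _ K′ a near-K′ Sa ≤-refl) le) ⟩
          suc (wt w K′ + wt w J″) ≡⟨ cong suc (wt-exchange w J′ P⊆) ⟩
          suc (wt w (J′ ⊕ (M ⊕ J′)) + wt w J′) ≡⟨ cong (λ c → suc (c + wt w J′)) (wt-cong w (λ e → xor-absorbᵐ (M e) (J′ e))) ⟩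
          suc (d + wt w J′) ≡⟨ sym (+-suc d _) ⟩
          d + suc (wt w J′) ∎)
          where open ≤-Reasoning

      min-cross : wt w J + cr J′ ≤ suc (wt w J′)
      min-cross =
        let (P , a , P⊆ , jP , Sa , crP) = first-hit (M ⊕ J′) S x Sx odd-J′
            (z , z0 , _ , jz) = zero-path Sa Sy
        in bound P a P⊆ jP Sa crP (min-J″ P a P⊆ jP Sa crP jz z0)

    odd-S : dot J S ≡ true
    odd-S = trans (sym (xor-identityʳ _)) (trans (cong (dot J S xor_) (sym M-none))
      (trans (sym (dot-⊕ J M S)) (trans (cut nearM S) (cong₂ _xor_ Sx Sy))))
      where
      M-none : dot M S ≡ false
      M-none = dot-closed M S (λ e Ke → ≢true (λ c → true≢false Ke (M-avoids e c)))

  near? : ∀ J K → Dec (∃[ x ] ∃[ y ] Near J K x y)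
  near? J K = any? (λ x → any? (λ y → join? (J ⊕ K) x y))

  nearest : ∀ w J → 0 < wt w J → Σ ES λ M → (∃[ x ] ∃[ y ] Near J M x y) ×
    (∀ K′ → ∃[ x ] ∃[ y ] Near J K′ x y → wt w M ≤ wt w K′)
  nearest w J pos = minimise (λ p (x , y , j) → x , y , Join-cong (λ e → cong (J e xor_) (p e)) j)
    (near? J) (wt w) (wt-cong w) (J , witness)
    where
    witness : ∃[ x ] ∃[ y ] Near J J x y
    witness = let (f , _) = wt-witness w J pos in
      end₁ G f , end₁ G f , Join-cong (λ e → sym (xor-same (J e))) (Join-∅ (end₁ G f))

  tight-cut : ∀ w J → EvenOnCycles w → Minimum w J → 0 < wt w J →
    Σ VS λ S → dot J S ≡ true × (∀ {e} → δ S e ≡ true → 1 ≤ w e) ×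
      (∀ C → Cycle C → wt w J + wt (cross S) (J ⊕ C) ≤ suc (wt w (J ⊕ C)))
  tight-cut w J even min pos =
    let (M , (x , y , near) , least) = nearest w J pos
        module T = TightCut w even J min pos M x y near (λ {K′} {u} {v} j → least K′ (u , v , j))
    in T.S , T.odd-S , T.S-pos , T.min-cross

  module Lowered (w : E → ℕ) (S : VS) (S-pos : ∀ {e} → δ S e ≡ true → 1 ≤ w e) where

    w′ : E → ℕ
    w′ e = w e ∸ cross S e

    -- Crossing edges have positive weight, so the truncated subtraction in `w′` is exact.
    split : ∀ e → w′ e + cross S e ≡ w e
    split e = m∸n+n≡m (cross≤w e (δ S e) refl)
      where
      cross≤w : ∀ e b → δ S e ≡ b → b2n b ≤ w e
      cross≤w e true p = S-pos p
      cross≤w e false _ = z≤n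

    wt-split : ∀ Q → wt w′ Q + wt (cross S) Q ≡ wt w Q
    wt-split Q = trans (sym (sum-+ (mask w′ Q) (mask (cross S) Q))) (sum-cong (λ e → pointwise (Q e) e))
      where
      pointwise : ∀ b e → (if b then w′ e else 0) + (if b then cross S e else 0) ≡ (if b then w e else 0)
      pointwise true e = split e
      pointwise false e = refl

    sum-split : sumℕ w′ + count (δ S) ≡ sumℕ w
    sum-split = trans (sym (sum-+ w′ (cross S))) (sum-cong split)

    even′ : EvenOnCycles w → EvenOnCycles w′
    even′ even C cyc = begin
      par (wt w′ C) ≡⟨ sym (xor-identityʳ _) ⟩
      par (wt w′ C) xor false ≡⟨ cong (par (wt w′ C) xor_) (sym (trans (par-cross S C) (even-cut cyc S))) ⟩
      par (wt w′ C) xor par (wt (cross S) C) ≡⟨ sym (par-+ (wt w′ C) _) ⟩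
      par (wt w′ C + wt (cross S) C) ≡⟨ cong par (wt-split C) ⟩
      par (wt w C) ≡⟨ even C cyc ⟩
      false ∎
      where open ≡-Reasoning

    module _ (J : ES) (odd : dot J S ≡ true)
      (min-cross : ∀ C → Cycle C → wt w J + wt (cross S) (J ⊕ C) ≤ suc (wt w (J ⊕ C))) where

      -- `min-cross` at the empty cycle allows at most one crossing, and oddness demands one.
      cross-J : wt (cross S) J ≡ 1
      cross-J = ≤-antisym (+-cancelˡ-≤ (wt w J) _ _ (begin
          wt w J + wt (cross S) J ≡⟨ cong (wt w J +_) (wt-cong (cross S) J⊕∅) ⟩
          wt w J + wt (cross S) (J ⊕ ∅) ≤⟨ min-cross ∅ Cycle-∅ ⟩
          suc (wt w (J ⊕ ∅)) ≡⟨ cong suc (wt-cong w (λ e → sym (J⊕∅ e))) ⟩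
          suc (wt w J) ≡⟨ +-comm 1 _ ⟩
          wt w J + 1 ∎))
        (n≢0⇒n>0 (λ z → true≢false odd (trans (sym (par-cross S J)) (cong par z))))
        where
        open ≤-Reasoning
        J⊕∅ : J ≗ J ⊕ ∅
        J⊕∅ e = sym (xor-identityʳ (J e))

      wt-J : wt w′ J + 1 ≡ wt w J
      wt-J = trans (cong (wt w′ J +_) (sym cross-J)) (wt-split J)

      -- `J ⊕ C` loses one unit per crossing. By `min-cross` it outweighs `J` by all of these but
      -- one, and one is what `J` loses.
      min′ : Minimum w′ J
      min′ C cyc = +-cancelʳ-≤ (suc c) _ _ (begin
        wt w′ J + suc c ≡⟨ sym (+-assoc (wt w′ J) 1 c) ⟩
        wt w′ J + 1 + c ≡⟨ cong (_+ c) wt-J ⟩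
        wt w J + c ≤⟨ min-cross C cyc ⟩
        suc (wt w (J ⊕ C)) ≡⟨ cong suc (sym (wt-split (J ⊕ C))) ⟩
        suc (wt w′ (J ⊕ C) + c) ≡⟨ sym (+-suc _ c) ⟩
        wt w′ (J ⊕ C) + suc c ∎)
        where
        open ≤-Reasoning
        c : ℕ
        c = wt (cross S) (J ⊕ C)

  one-third : ∀ b w J → sumℕ w < b → EvenOnCycles w → Odd3 J → Minimum w J → 3 * wt w J ≤ sumℕ w
  one-third (suc b) w J lt even odd3 min = cases (wt w J) refl
    where
    cases : ∀ k → wt w J ≡ k → 3 * wt w J ≤ sumℕ w
    cases zero eq = ≤-trans (≤-reflexive (cong (3 *_) eq)) z≤n
    cases (suc _) eq =
      let (S , odd , S-pos , min-cross) = tight-cut w J even min (subst (0 <_) (sym eq) (s≤s z≤n))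
          module L = Lowered w S S-pos
          w′<w = ≤-trans (≤-trans (≤-reflexive (+-comm 1 _)) (+-monoʳ-≤ (sumℕ L.w′) (≤-trans (s≤s z≤n) (odd3 S odd))))
                   (≤-reflexive L.sum-split)
          ih = one-third b L.w′ J (<-≤-trans w′<w (s≤s⁻¹ lt)) (L.even′ even) odd3 (L.min′ J odd min-cross)
      in begin
        3 * wt w J ≡⟨ cong (3 *_) (sym (L.wt-J J odd min-cross)) ⟩
        3 * (wt L.w′ J + 1) ≡⟨ *-distribˡ-+ 3 (wt L.w′ J) 1 ⟩
        3 * wt L.w′ J + 3 ≤⟨ +-mono-≤ ih (odd3 S odd) ⟩
        sumℕ L.w′ + count (δ S) ≡⟨ L.sum-split ⟩
        sumℕ w ∎
      where open ≤-Reasoning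

-- Double counting of weights over edges and cuts.

sum-tight : ∀ {k} (f g : Fin k → ℕ) → (∀ i → g i ≤ f i) → sumℕ f ≤ sumℕ g → ∀ i → f i ≡ g i
sum-tight {suc k} f g le tot zero = ≤-antisym
  (+-cancelʳ-≤ (sumℕ (λ i → g (suc i))) _ _
    (≤-trans (+-monoʳ-≤ (f zero) (sum-mono (λ i → le (suc i)))) tot)) (le zero)
sum-tight {suc k} f g le tot (suc i) = sum-tight (λ i → f (suc i)) (λ i → g (suc i)) (λ i → le (suc i))
  (+-cancelˡ-≤ (g zero) _ _ (≤-trans (+-monoˡ-≤ _ (le zero)) tot)) i

count-one : ∀ {k} (P : Fin k → Bool) → count P ≡ 1 → ∀ i j → P i ≡ true → P j ≡ true → i ≡ j
count-one P one i j pi pj with i ≟ j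
... | yes q = q
... | no i≢j = contradiction (≤-trans
  (≤-trans (≤-reflexive (cong suc (sym (count-eqB i)))) (count-strict (eqB-⊆ {P = P} pi) j (eqB-≢ i≢j) pj))
  (≤-reflexive one)) 1+n≰n

wt-swap : ∀ {k l} (c : Fin l → Fin k → ℕ) (t : Fin l → Bool) (Q : Fin k → Bool) →
  wt (λ e → wt (λ i → c i e) t) Q ≡ wt (λ i → wt (c i) Q) t
wt-swap c t Q = trans (sum-cong (λ e → pull (Q e) (λ i → if t i then c i e else 0)))
  (trans (sum-swap (λ e i → if Q e then (if t i then c i e else 0) else 0))
  (sum-cong (λ i → trans (sum-cong (λ e → flip-if (Q e) (t i) (c i e))) (sym (pull (t i) (mask (c i) Q))))))
  where
  pull : ∀ {k} b (f : Fin k → ℕ) → (if b then sumℕ f else 0) ≡ sumℕ (λ i → if b then f i else 0)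
  pull true f = refl
  pull {k} false f = sym (sum-0 k)
  flip-if : ∀ a b (x : ℕ) → (if a then (if b then x else 0) else 0) ≡ (if b then (if a then x else 0) else 0)
  flip-if true true x = refl
  flip-if true false x = refl
  flip-if false true x = refl
  flip-if false false x = refl

wt-* : ∀ {k} c (w : Fin k → ℕ) Q → wt (λ e → c * w e) Q ≡ c * wt w Q
wt-* c w Q = trans (sum-cong (λ e → pointwise (Q e) e)) (sum-* c (mask w Q))
  where
  pointwise : ∀ b e → (if b then c * w e else 0) ≡ c * (if b then w e else 0)
  pointwise true e = refl
  pointwise false e = sym (*-zeroʳ c)

wt-+ : ∀ {k} (w v : Fin k → ℕ) Q → wt (λ e → w e + v e) Q ≡ wt w Q + wt v Q
wt-+ w v Q = trans (sum-cong (λ e → pointwise (Q e) e)) (sum-+ (mask w Q) (mask v Q))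
  where
  pointwise : ∀ b e → (if b then w e + v e else 0) ≡ (if b then w e else 0) + (if b then v e else 0)
  pointwise true e = refl
  pointwise false e = refl

wt-single : ∀ {k} (f : Fin k) Q → wt (λ e → b2n (eqB f e)) Q ≡ b2n (Q f)
wt-single f Q = trans (sum-cong (λ e → swap-if (Q e) (eqB f e))) (wt-eqB (λ e → b2n (Q e)) f)
  where
  swap-if : ∀ a b → (if a then b2n b else 0) ≡ (if b then b2n a else 0)
  swap-if true true = refl
  swap-if true false = refl
  swap-if false true = refl
  swap-if false false = refl

par-2* : ∀ k → par (2 * k) ≡ false
par-2* k = trans (cong (λ j → par (k + j)) (+-identityʳ k)) (trans (par-+ k k) (xor-same (par k)))

-- Bridges and vertex stars as cuts.

module _ (G : Graph) where
  open Cuts G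

  joins-ends : ∀ g u v → joinsB G g u v ≡ true →
    (end₁ G g ≡ u × end₂ G g ≡ v) ⊎ (end₁ G g ≡ v × end₂ G g ≡ u)
  joins-ends g u v p with ∨-true p
  ... | inj₁ q = inj₁ (eqB-true _ _ (proj₁ (∧-true q)) , eqB-true _ _ (proj₂ (∧-true {eqB (end₁ G g) u} q)))
  ... | inj₂ q = inj₂ (eqB-true _ _ (proj₁ (∧-true q)) , eqB-true _ _ (proj₂ (∧-true {eqB (end₁ G g) v} q)))

  δ-joins : ∀ S {g u v} → joinsB G g u v ≡ true → δ S g ≡ S u xor S v
  δ-joins S {g} {u} {v} p with joins-ends g u v p
  ... | inj₁ (refl , refl) = refl
  ... | inj₂ (refl , refl) = xor-comm (S v) (S u)

  walk-closed : ∀ S {P u v} → (∀ g → P g → δ S g ≡ false) → Walk G P u v → S u ≡ S v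
  walk-closed S c here = refl
  walk-closed S c (step g Pg j rest) = trans (xor-false (trans (sym (δ-joins S j)) (c g Pg))) (walk-closed S c rest)

  no-bridge : Bridgeless G → ∀ S → count (δ S) ≢ 1
  no-bridge bridgeless S one =
    let (e , δe) = count-witness (δ S) (≤-reflexive (sym one))
        same = walk-closed S (λ g g≢e → ≢true (λ δg → g≢e (count-one (δ S) one g e δg δe))) (bridgeless e)
    in true≢false δe (trans (cong (_xor S (end₂ G e)) same) (xor-same (S (end₂ G e))))

  δ-star : ∀ v e → b2n (δ (eqB v) e) ≡ incid G e v
  δ-star v e = trans (pointwise (eqB v (end₁ G e)) (eqB v (end₂ G e)) disjoint)
    (cong₂ _+_ (cong b2n (eqB-sym v (end₁ G e))) (cong b2n (eqB-sym v (end₂ G e))))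
    where
    disjoint : eqB v (end₁ G e) ≡ true → eqB v (end₂ G e) ≡ true → ⊥
    disjoint p q = loopless G e (trans (sym (eqB-true v _ p)) (eqB-true v _ q))
    pointwise : ∀ a b → (a ≡ true → b ≡ true → ⊥) → b2n (a xor b) ≡ b2n a + b2n b
    pointwise true true d = ⊥-elim (d refl refl)
    pointwise true false d = refl
    pointwise false b d = refl

  count-star : ∀ v → count (δ (eqB v)) ≡ degree G v
  count-star v = sum-cong (δ-star v)

  wt-star : ∀ v F → wt (λ e → b2n (δ (eqB v) e)) F ≡ sumℕ (λ e → if F e then incid G e v else 0)
  wt-star v F = sum-cong (λ e → cong (λ k → if F e then k else 0) (δ-star v e))

-- The perfect matching through `e` that meets every 3-cut exactly once.

module Matching (G : Graph) (bridgeless : Bridgeless G) (cubic : Cubic G) (e : Fin (m G)) where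
  open Cuts G
  open Weights G
  open MinimumJoin G

  cut-of : Fin (2 ^ n G) → VS
  cut-of = enum

  -- Indices stand for vertex sets, so a cut is counted once for every set that induces it. `N` and
  -- `h` count with the same multiplicity.
  three : Fin (2 ^ n G) → Bool
  three i = count (δ (cut-of i)) ℕ.≡ᵇ 3

  three-eq : ∀ i → three i ≡ true → count (δ (cut-of i)) ≡ 3
  three-eq i = is-three (count (δ (cut-of i)))
    where
    is-three : ∀ k → (k ℕ.≡ᵇ 3) ≡ true → k ≡ 3
    is-three 3 _ = refl

  N : ℕ
  N = count three

  h : E → ℕ
  h f = wt (λ i → cross (cut-of i) f) three

  three-code : ∀ S → count (δ S) ≡ 3 → three (code S) ≡ true
  three-code S p = cong (ℕ._≡ᵇ 3) (trans (count-cong (δ-cong (enum-code S))) p)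

  -- In a cubic graph the star of an end of `e` is a 3-cut. This makes the truncated subtraction in
  -- `w` exact.
  h-pos : 1 ≤ h e
  h-pos = ≤-trans (≤-reflexive (sym c)) (wt-term (λ i → cross (cut-of i) e) three (code star)
      (three-code star (trans (count-star G v) (cubic v))))
    where
    v : V
    v = end₁ G e
    star : VS
    star = eqB v
    c : cross (cut-of (code star)) e ≡ 1
    c = cong b2n (trans (δ-cong (enum-code star) e)
      (cong₂ _xor_ (eqB-refl v) (eqB-≢ (loopless G e))))

  -- Minimising w meets every 3-cut as rarely as possible and, among such joins, prefers to contain e.
  w : E → ℕ
  w f = 4 * h f ∸ 2 * b2n (eqB e f)

  w-split : ∀ f → w f + 2 * b2n (eqB e f) ≡ 4 * h f
  w-split f = m∸n+n≡m (bound (e ≟ f))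
    where
    bound : (d : Dec (e ≡ f)) → 2 * b2n (does d) ≤ 4 * h f
    bound (yes refl) = ≤-trans (s≤s (s≤s z≤n)) (*-monoʳ-≤ 4 h-pos)
    bound (no _) = z≤n

  wt-w : ∀ Q → wt w Q + 2 * b2n (Q e) ≡ 4 * wt h Q
  wt-w Q = begin
    wt w Q + 2 * b2n (Q e) ≡⟨ cong (λ k → wt w Q + 2 * k) (sym (wt-single e Q)) ⟩
    wt w Q + 2 * wt (λ f → b2n (eqB e f)) Q ≡⟨ cong (wt w Q +_) (sym (wt-* 2 _ Q)) ⟩
    wt w Q + wt (λ f → 2 * b2n (eqB e f)) Q ≡⟨ sym (wt-+ w _ Q) ⟩
    wt (λ f → w f + 2 * b2n (eqB e f)) Q ≡⟨ sum-cong (λ f → cong (λ k → if Q f then k else 0) (w-split f)) ⟩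
    wt (λ f → 4 * h f) Q ≡⟨ wt-* 4 h Q ⟩
    4 * wt h Q ∎
    where open ≡-Reasoning

  wt-h : ∀ Q → wt h Q ≡ wt (λ i → wt (cross (cut-of i)) Q) three
  wt-h Q = wt-swap (λ i f → cross (cut-of i) f) three Q

  full : ES
  full _ = true

  sum-h : wt h full ≡ 3 * N
  sum-h = trans (wt-h full) (trans (sum-cong (λ i → pointwise (three i) (three-eq i))) (sum-* 3 (λ i → b2n (three i))))
    where
    pointwise : ∀ {k} b → (b ≡ true → k ≡ 3) → (if b then k else 0) ≡ 3 * b2n b
    pointwise true p = p refl
    pointwise false _ = refl

  even : EvenOnCycles w
  even C _ = begin
    par (wt w C) ≡⟨ sym (xor-identityʳ _) ⟩
    par (wt w C) xor false ≡⟨ cong (par (wt w C) xor_) (sym (par-2* (b2n (C e)))) ⟩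
    par (wt w C) xor par (2 * b2n (C e)) ≡⟨ sym (par-+ (wt w C) _) ⟩
    par (wt w C + 2 * b2n (C e)) ≡⟨ cong par (wt-w C) ⟩
    par (4 * wt h C) ≡⟨ cong par (*-assoc 2 2 (wt h C)) ⟩
    par (2 * (2 * wt h C)) ≡⟨ par-2* (2 * wt h C) ⟩
    false ∎
    where open ≡-Reasoning

  -- All degrees are odd, so the set of all edges is itself a T-join for `T = V`; the candidates are
  -- the sets that differ from it by a cycle.
  minimum : Σ ES λ J → Cycle (full ⊕ J) × (∀ K → Cycle (full ⊕ K) → wt w J ≤ wt w K)
  minimum = minimise (λ p → Cycle-cong (λ f → cong (true xor_) (p f))) (λ J → cycle? (full ⊕ J)) (wt w) (wt-cong w)
    (full , Cycle-cong (λ _ → refl) Cycle-∅)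

  J : ES
  J = proj₁ minimum

  J-min : Minimum w J
  J-min C cyc = proj₂ (proj₂ minimum) (J ⊕ C)
    (Cycle-cong (λ f → xor-assoc true (J f) (C f)) (Cycle-⊕ (proj₁ (proj₂ minimum)) cyc))

  dot-J : ∀ S → dot J S ≡ par (count (δ S))
  dot-J S = begin
    dot J S ≡⟨ sym (xor-false (trans (sym (dot-⊕ full J S)) (even-cut (proj₁ (proj₂ minimum)) S))) ⟩
    dot full S ≡⟨ sym (par-count (δ S)) ⟩
    par (count (δ S)) ∎
    where open ≡-Reasoning

  odd3 : Odd3 J
  odd3 S p = three≤ (count (δ S)) (trans (sym (dot-J S)) p) (no-bridge G bridgeless S)
    where
    three≤ : ∀ k → par k ≡ true → k ≢ 1 → 3 ≤ k
    three≤ 1 _ q = contradiction refl q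
    three≤ (suc (suc (suc k))) _ _ = s≤s (s≤s (s≤s z≤n))

  tight : 12 * wt h J + 2 ≤ 12 * N + 6 * b2n (J e)
  tight = begin
    12 * wt h J + 2 ≡⟨ cong (_+ 2) (*-assoc 3 4 (wt h J)) ⟩
    3 * (4 * wt h J) + 2 ≡⟨ cong (λ k → 3 * k + 2) (sym (wt-w J)) ⟩
    3 * (wt w J + 2 * b2n (J e)) + 2 ≡⟨ cong (_+ 2) (*-distribˡ-+ 3 (wt w J) _) ⟩
    3 * wt w J + 3 * (2 * b2n (J e)) + 2 ≡⟨ cong (λ k → 3 * wt w J + k + 2) (sym (*-assoc 3 2 (b2n (J e)))) ⟩
    3 * wt w J + 6 * b2n (J e) + 2 ≡⟨ +-assoc (3 * wt w J) _ 2 ⟩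
    3 * wt w J + (6 * b2n (J e) + 2) ≤⟨ +-monoˡ-≤ _ (one-third _ w J ≤-refl even odd3 J-min) ⟩
    sumℕ w + (6 * b2n (J e) + 2) ≡⟨ cong (sumℕ w +_) (+-comm _ 2) ⟩
    sumℕ w + (2 + 6 * b2n (J e)) ≡⟨ sym (+-assoc (sumℕ w) 2 _) ⟩
    sumℕ w + 2 + 6 * b2n (J e) ≡⟨ cong (_+ 6 * b2n (J e)) (trans (wt-w full) (trans (cong (4 *_) sum-h) (sym (*-assoc 4 3 N)))) ⟩
    12 * N + 6 * b2n (J e) ∎
    where open ≤-Reasoning

  meets : ∀ i → three i ≡ true → 1 ≤ wt (cross (cut-of i)) J
  meets i p = n≢0⇒n>0 λ z → true≢false (trans (dot-J (cut-of i)) (cong par (three-eq i p)))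
    (trans (sym (par-cross (cut-of i) J)) (cong par z))

  below : ∀ i → b2n (three i) ≤ (if three i then wt (cross (cut-of i)) J else 0)
  below i = pointwise (three i) (meets i)
    where
    pointwise : ∀ {k} b → (b ≡ true → 1 ≤ k) → b2n b ≤ (if b then k else 0)
    pointwise true p = p refl
    pointwise false _ = z≤n

  N≤ : N ≤ wt h J
  N≤ = ≤-trans (sum-mono below) (≤-reflexive (sym (wt-h J)))

  e∈J : J e ≡ true
  e∈J = contains (J e) refl
    where
    contains : ∀ b → J e ≡ b → J e ≡ true
    contains true p = p
    contains false p = contradiction (begin
      suc (12 * N) ≤⟨ s≤s (*-monoʳ-≤ 12 N≤) ⟩
      suc (12 * wt h J) ≤⟨ n≤1+n _ ⟩
      2 + 12 * wt h J ≡⟨ +-comm 2 _ ⟩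
      12 * wt h J + 2 ≤⟨ tight ⟩
      12 * N + 6 * b2n (J e) ≡⟨ cong (λ b → 12 * N + 6 * b2n b) p ⟩
      12 * N + 0 ≡⟨ +-identityʳ _ ⟩
      12 * N ∎) 1+n≰n
      where open ≤-Reasoning

  ≤N : wt h J ≤ N
  ≤N = ≮⇒≥ λ lt → contradiction (begin
    suc (12 * N + 12) ≡⟨ cong suc (trans (+-comm _ 12) (sym (*-suc 12 N))) ⟩
    suc (12 * suc N) ≤⟨ s≤s (*-monoʳ-≤ 12 lt) ⟩
    suc (12 * wt h J) ≤⟨ n≤1+n _ ⟩
    2 + 12 * wt h J ≡⟨ +-comm 2 _ ⟩
    12 * wt h J + 2 ≤⟨ tight ⟩
    12 * N + 6 * b2n (J e) ≤⟨ +-monoʳ-≤ (12 * N) (*-monoʳ-≤ 6 (b2n≤1 (J e))) ⟩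
    12 * N + 6 ≤⟨ +-monoʳ-≤ (12 * N) (m≤m+n 6 6) ⟩
    12 * N + 12 ∎) 1+n≰n
    where open ≤-Reasoning

  once : ∀ S → count (δ S) ≡ 3 → wt (cross S) J ≡ 1
  once S p = begin
    wt (cross S) J ≡⟨ sum-cong (λ f → cong (λ b → if J f then b2n b else 0) (sym (δ-cong (enum-code S) f))) ⟩
    wt (cross (cut-of i)) J ≡⟨ cong (λ b → if b then wt (cross (cut-of i)) J else 0) (sym t) ⟩
    -- Every 3-cut contributes at least 1 and the contributions add up to at most `N`, so no term
    -- can exceed 1.
    (if three i then wt (cross (cut-of i)) J else 0) ≡⟨ sum-tight _ (λ i → b2n (three i)) below
      (≤-trans (≤-reflexive (sym (wt-h J))) ≤N) i ⟩
    b2n (three i) ≡⟨ cong b2n t ⟩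
    1 ∎
    where
    open ≡-Reasoning
    i : Fin (2 ^ n G)
    i = code S
    t : three i ≡ true
    t = three-code S p

  perfect : PerfectMatching G J
  perfect v = trans (sym (wt-star G v J)) (once (eqB v) (trans (count-star G v) (cubic v)))

-- The number of components and its supermodularity.

infixl 6 _∪_
infixl 7 _∩_
_∪_ _∩_ : ∀ {k} → (Fin k → Bool) → (Fin k → Bool) → Fin k → Bool
(P ∪ Q) i = P i ∨ Q i
(P ∩ Q) i = P i ∧ Q i

module Components (G : Graph) where
  open Cuts G

  smaller : ES → V → V → Bool
  smaller A v u = does (u Fin.<? v) ∧ conn A u v

  least : ES → VS
  least A v = not (anyFin (smaller A v))

  least-out : ∀ A {u v} → least A v ≡ true → u Fin.< v → conn A u v ≡ true → ⊥
  least-out A {u} {v} p lt c = true≢false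
    (anyFin-intro (smaller A v) u (cong₂ _∧_ (dec-true (u Fin.<? v) lt) c)) (not-true p)

  least-not : ∀ A v → least A v ≡ false → ∃[ u ] u Fin.< v × conn A u v ≡ true
  least-not A v p =
    let (u , q) = anyFin-true (smaller A v) (not-false p)
        (l , c) = ∧-true {does (u Fin.<? v)} q
    in u , is-less (u Fin.<? v) l , c
    where
    is-less : ∀ {P : Set} (d : Dec P) → does d ≡ true → P
    is-less (yes p) _ = p

  -- The number of components, each counted at its least vertex.
  comps : ES → ℕ
  comps A = count (least A)

  comps-cong : ∀ {A B} → A ≗ B → comps A ≡ comps B
  comps-cong p = count-cong (λ v → cong not (anyFin-cong (λ u →
    cong (does (u Fin.<? v) ∧_) (reachF-cong (λ e → cong not (p e)) (n G) u v))))

  least-unique : ∀ A u v → least A u ≡ true → least A v ≡ true → conn A u v ≡ true → u ≡ v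
  least-unique A u v lu lv c with Fin.<-cmp u v
  ... | tri< lt _ _ = ⊥-elim (least-out A lv lt c)
  ... | tri≈ _ eq _ = eq
  ... | tri> _ _ gt = ⊥-elim (least-out A lu gt (conn-sym A c))

  least-exists : ∀ A u → ∃[ v ] least A v ≡ true × conn A v u ≡ true
  least-exists A u = go (suc (Fin.toℕ u)) u ≤-refl
    where
    go : ∀ b u → Fin.toℕ u < b → ∃[ v ] least A v ≡ true × conn A v u ≡ true
    go (suc b) u (s≤s le) with bool-cases (least A u)
    ... | inj₁ l = u , l , conn-refl A u
    ... | inj₂ l =
      let (t , lt , c) = least-not A u l
          (v , lv , c′) = go b t (<-≤-trans lt le)
      in v , lv , conn-trans A c′ c

  least-mono : ∀ {A B} → A ⊆ B → least B ⊆ least A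
  least-mono {A} {B} sub v lv with bool-cases (least A v)
  ... | inj₁ l = l
  ... | inj₂ l = let (u , lt , c) = least-not A v l in ⊥-elim (least-out B lv lt (conn-mono sub c))

  comps-mono : ∀ {A B} → A ⊆ B → comps B ≤ comps A
  comps-mono sub = count-mono (least-mono sub)

  add : ES → E → ES
  add A x = A ∪ eqB x

  ⊆-add : ∀ A x → A ⊆ add A x
  ⊆-add A x e p = ∨-trueˡ _ p

  ∈-add : ∀ A x → add A x x ≡ true
  ∈-add A x = ∨-trueʳ (A x) (eqB-refl x)

  Closed-add : ∀ A x S → Closed A S → δ S x ≡ false → Closed (add A x) S
  Closed-add A x S c δx e p with ∨-true {A e} p
  ... | inj₁ q = c e q
  ... | inj₂ q = subst (λ f → δ S f ≡ false) (eqB-true x e q) δx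

  conn-edge : ∀ A x → A x ≡ true → conn A (end₁ G x) (end₂ G x) ≡ true
  conn-edge A x p = trans (sym (xor-false (conn-Closed A (end₁ G x) x p))) (conn-refl A (end₁ G x))

  module _ (A : ES) (x : E) where
    private
      p q : V
      p = end₁ G x
      q = end₂ G x

    comps-joined : conn A p q ≡ true → comps A ≤ comps (add A x)
    comps-joined c = count-mono keep
      where
      keep : least A ⊆ least (add A x)
      keep v lv with bool-cases (least (add A x) v)
      ... | inj₁ l = l
      ... | inj₂ l =
        let (u , lt , cu) = least-not (add A x) v l
            S = conn A u
            δx = trans (cong (_xor S q) (conn-least A S (conn-Closed A u) c)) (xor-same (S q))
            closed = Closed-add A x S (conn-Closed A u) δx
        in ⊥-elim (least-out A lv lt (trans (sym (conn-least (add A x) S closed cu)) (conn-refl A u)))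

    -- The least vertices of the two merged components become connected, so the larger one is no
    -- longer least.
    comps-separate : conn A p q ≡ false → suc (comps (add A x)) ≤ comps A
    comps-separate sep = compare (least-exists A p) (least-exists A q)
      where
      lift : ∀ {u v} → conn A u v ≡ true → conn (add A x) u v ≡ true
      lift = conn-mono (⊆-add A x)
      compare : (∃[ v ] least A v ≡ true × conn A v p ≡ true) → (∃[ v ] least A v ≡ true × conn A v q ≡ true) →
        suc (comps (add A x)) ≤ comps A
      compare (v , lv , vp) (u , lu , uq) with Fin.<-cmp v u
        | conn-trans (add A x) (lift vp) (conn-trans (add A x) (conn-edge (add A x) x (∈-add A x)) (conn-sym (add A x) (lift uq)))
      ... | tri< lt _ _ | c = count-strict (least-mono (⊆-add A x)) u (≢true λ l → least-out (add A x) l lt c) lu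
      ... | tri≈ _ refl _ | _ = ⊥-elim (true≢false (conn-trans A (conn-sym A vp) uq) sep)
      ... | tri> _ _ gt | c = count-strict (least-mono (⊆-add A x)) v
        (≢true λ l → least-out (add A x) l gt (conn-sym (add A x) c)) lv

    lost : VS
    lost v = least A v ∧ not (least (add A x) v)

    lost-smaller : ∀ v → lost v ≡ true → ∃[ u ] u Fin.< v × conn (add A x) u v ≡ true
    lost-smaller v l = least-not (add A x) v (not-true (proj₂ (∧-true {least A v} l)))

    lost-least : ∀ v → lost v ≡ true → least A v ≡ true
    lost-least v l = proj₁ (∧-true l)

    lost-end : ∀ v → lost v ≡ true → conn A p v ≡ true ⊎ conn A q v ≡ true
    lost-end v l with bool-cases (conn A v p) | bool-cases (conn A v q)
    ... | inj₁ c | _ = inj₁ (conn-sym A c)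
    ... | inj₂ _ | inj₁ c = inj₂ (conn-sym A c)
    ... | inj₂ vp | inj₂ vq =
      let (u , lt , c) = lost-smaller v l
          S = conn A v
          closed = Closed-add A x S (conn-Closed A v) (cong₂ _xor_ vp vq)
          vu = trans (conn-least (add A x) S closed c) (conn-refl A v)
      in ⊥-elim (least-out A (lost-least v l) lt (conn-sym A vu))

    -- Of the two least vertices being merged, the smaller survives.
    lost-apart : ∀ u v → lost u ≡ true → lost v ≡ true → u Fin.< v →
      ∀ S → Closed A S → S p ≡ true → S q ≡ true →
      (∀ t → S t ≡ true → conn A t u ≡ true ⊎ conn A t v ≡ true) → S u ≡ true → ⊥
    lost-apart u v lu lv lt S cS Sp Sq cover Su =
      let (t , t<u , c) = lost-smaller u lu
          St = trans (conn-least (add A x) S (Closed-add A x S cS (cong₂ _xor_ Sp Sq)) c) Su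
      in split t t<u (cover t St)
      where
      split : ∀ t → t Fin.< u → conn A t u ≡ true ⊎ conn A t v ≡ true → ⊥
      split t t<u (inj₁ c) = least-out A (lost-least u lu) t<u c
      split t t<u (inj₂ c) = least-out A (lost-least v lv) (<-trans t<u lt) c

    both : VS
    both = conn A p ∪ conn A q

    both-p : both p ≡ true
    both-p = ∨-trueˡ _ (conn-refl A p)

    both-q : both q ≡ true
    both-q = ∨-trueʳ (conn A p q) (conn-refl A q)

    both-closed : Closed A both
    both-closed e Ae = trans (cong₂ (λ a b → (a ∨ b) xor both (end₂ G e))
        (xor-false {conn A p (end₁ G e)} {conn A p (end₂ G e)} (conn-Closed A p e Ae))
        (xor-false {conn A q (end₁ G e)} {conn A q (end₂ G e)} (conn-Closed A q e Ae))) (xor-same (both (end₂ G e)))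

    lost-merge : ∀ u v → lost u ≡ true → lost v ≡ true → conn A p u ≡ true → conn A q v ≡ true → u ≡ v
    lost-merge u v lu lv pu qv with Fin.<-cmp u v
    ... | tri≈ _ eq _ = eq
    ... | tri< lt _ _ = ⊥-elim (lost-apart u v lu lv lt both both-closed both-p both-q cover (∨-trueˡ _ pu))
      where
      cover : ∀ t → both t ≡ true → conn A t u ≡ true ⊎ conn A t v ≡ true
      cover t b = Sum.map (λ pt → conn-trans A (conn-sym A pt) pu) (λ qt → conn-trans A (conn-sym A qt) qv) (∨-true b)
    ... | tri> _ _ gt = ⊥-elim (lost-apart v u lv lu gt both both-closed both-p both-q cover (∨-trueʳ (conn A p v) qv))
      where
      cover : ∀ t → both t ≡ true → conn A t v ≡ true ⊎ conn A t u ≡ true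
      cover t b = Sum.swap (Sum.map (λ pt → conn-trans A (conn-sym A pt) pu) (λ qt → conn-trans A (conn-sym A qt) qv) (∨-true b))

    -- A lost vertex lies in the component of an end of `x`. Two in the same component are both its
    -- least vertex; two in different ones contradict `lost-apart`.
    lost-unique : ∀ u v → lost u ≡ true → lost v ≡ true → u ≡ v
    lost-unique u v lu lv with lost-end u lu | lost-end v lv
    ... | inj₁ pu | inj₁ pv = least-unique A u v (lost-least u lu) (lost-least v lv) (conn-trans A (conn-sym A pu) pv)
    ... | inj₂ qu | inj₂ qv = least-unique A u v (lost-least u lu) (lost-least v lv) (conn-trans A (conn-sym A qu) qv)
    ... | inj₁ pu | inj₂ qv = lost-merge u v lu lv pu qv
    ... | inj₂ qu | inj₁ pv = sym (lost-merge v u lv lu pv qu)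

    comps-drop : comps A ≤ suc (comps (add A x))
    comps-drop = begin
      comps A ≤⟨ sum-mono (λ v → pointwise (least A v) (least (add A x) v)) ⟩
      sumℕ (λ v → b2n (lost v) + b2n (least (add A x) v)) ≡⟨ sum-+ (λ v → b2n (lost v)) (λ v → b2n (least (add A x) v)) ⟩
      count lost + comps (add A x) ≤⟨ +-monoˡ-≤ _ (count-unique lost lost-unique) ⟩
      suc (comps (add A x)) ∎
      where
      open ≤-Reasoning
      pointwise : ∀ a b → b2n a ≤ b2n (a ∧ not b) + b2n b
      pointwise false b = z≤n
      pointwise true false = s≤s z≤n
      pointwise true true = s≤s z≤n

  add-mono : ∀ {A B} x → A ⊆ B → add A x ⊆ add B x
  add-mono {A} {B} x sub e p with ∨-true {A e} p
  ... | inj₁ q = ∨-trueˡ _ (sub e q)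
  ... | inj₂ q = ∨-trueʳ (B e) q

  -- Diminishing returns, that is, submodularity of the rank of the graphic matroid: an edge that
  -- merges components of the larger set also merges components of the smaller one.
  comps-marginal : ∀ {A B} → A ⊆ B → ∀ x → comps (add A x) + comps B ≤ comps A + comps (add B x)
  comps-marginal {A} {B} sub x with bool-cases (conn B (end₁ G x) (end₂ G x))
  ... | inj₁ c = +-mono-≤ (comps-mono (⊆-add A x)) (comps-joined B x c)
  ... | inj₂ sep = begin
    comps (add A x) + comps B ≤⟨ +-monoʳ-≤ (comps (add A x)) (comps-drop B x) ⟩
    comps (add A x) + suc (comps (add B x)) ≡⟨ +-suc _ _ ⟩
    suc (comps (add A x)) + comps (add B x) ≤⟨ +-monoˡ-≤ _ (comps-separate A x (≢true λ c → true≢false (conn-mono sub c) sep)) ⟩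
    comps A + comps (add B x) ∎
    where open ≤-Reasoning

  addAll : ES → ES → List E → ES
  addAll A X [] = A
  addAll A X (x ∷ L) = if X x then add (addAll A X L) x else addAll A X L

  addAll-mono : ∀ {A B} X L → A ⊆ B → addAll A X L ⊆ addAll B X L
  addAll-mono X [] sub = sub
  addAll-mono X (x ∷ L) sub with X x
  ... | true = add-mono x (addAll-mono X L sub)
  ... | false = addAll-mono X L sub

  addAll-⊇ : ∀ A X L → A ⊆ addAll A X L
  addAll-⊇ A X [] e p = p
  addAll-⊇ A X (x ∷ L) e p with X x
  ... | true = ∨-trueˡ _ (addAll-⊇ A X L e p)
  ... | false = addAll-⊇ A X L e p

  addAll-∈ : ∀ A X L e → X e ≡ true → e ∈ L → addAll A X L e ≡ true
  addAll-∈ A X (x ∷ L) .x Xe (here refl) rewrite Xe = ∈-add (addAll A X L) x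
  addAll-∈ A X (x ∷ L) e Xe (there i) with X x
  ... | true = ∨-trueˡ _ (addAll-∈ A X L e Xe i)
  ... | false = addAll-∈ A X L e Xe i

  addAll-⊆ : ∀ A X L → addAll A X L ⊆ A ∪ X
  addAll-⊆ A X [] e p = ∨-trueˡ _ p
  addAll-⊆ A X (x ∷ L) e p with X x in eq
  ... | false = addAll-⊆ A X L e p
  ... | true with ∨-true {addAll A X L e} p
  ...   | inj₁ q = addAll-⊆ A X L e q
  ...   | inj₂ q = ∨-trueʳ (A e) (subst (λ f → X f ≡ true) (eqB-true x e q) eq)

  addAll-all : ∀ A X → addAll A X (allFin (m G)) ≗ A ∪ X
  addAll-all A X e = bool-ext (addAll-⊆ A X (allFin (m G)) e) λ p → from (∨-true {A e} p)
    where
    from : A e ≡ true ⊎ X e ≡ true → addAll A X (allFin (m G)) e ≡ true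
    from (inj₁ q) = addAll-⊇ A X (allFin (m G)) e q
    from (inj₂ q) = addAll-∈ A X (allFin (m G)) e q (∈-allFin e)

  comps-addAll : ∀ {A B} X L → A ⊆ B → comps (addAll A X L) + comps B ≤ comps A + comps (addAll B X L)
  comps-addAll X [] sub = ≤-refl
  comps-addAll {A} {B} X (x ∷ L) sub with X x
  ... | false = comps-addAll X L sub
  ... | true = +-cancelʳ-≤ (comps A′ + comps B′) _ _ (begin
      (comps (add A′ x) + comps B) + (comps A′ + comps B′) ≡⟨ shuffle₁ (comps (add A′ x)) (comps B) (comps A′) (comps B′) ⟩
      (comps (add A′ x) + comps B′) + (comps A′ + comps B) ≤⟨ +-mono-≤ (comps-marginal (addAll-mono X L sub) x) (comps-addAll X L sub) ⟩
      (comps A′ + comps (add B′ x)) + (comps A + comps B′) ≡⟨ shuffle₂ (comps A′) (comps (add B′ x)) (comps A) (comps B′) ⟩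
      (comps A + comps (add B′ x)) + (comps A′ + comps B′) ∎)
    where
    open ≤-Reasoning
    open +-*-Solver
    A′ B′ : ES
    A′ = addAll A X L
    B′ = addAll B X L
    shuffle₁ : ∀ a b c d → (a + b) + (c + d) ≡ (a + d) + (c + b)
    shuffle₁ = solve 4 (λ a b c d → (a :+ b) :+ (c :+ d) := (a :+ d) :+ (c :+ b)) refl
    shuffle₂ : ∀ a b c d → (a + b) + (c + d) ≡ (c + b) + (a + d)
    shuffle₂ = solve 4 (λ a b c d → (a :+ b) :+ (c :+ d) := (c :+ b) :+ (a :+ d)) refl

  -- Adding the edges of `X` one by one turns `X ∩ Y` into `X` and `Y` into `X ∪ Y`; by
  -- `comps-addAll` the first process loses at least as many components.
  comps-supermodular : ∀ X Y → comps X + comps Y ≤ comps (X ∪ Y) + comps (X ∩ Y)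
  comps-supermodular X Y = begin
    comps X + comps Y ≡⟨ cong (_+ comps Y) (comps-cong (λ e → sym (trans (addAll-all (X ∩ Y) X e) (absorb (X e) (Y e))))) ⟩
    comps (addAll (X ∩ Y) X L) + comps Y ≤⟨ comps-addAll X L (λ e p → proj₂ (∧-true {X e} p)) ⟩
    comps (X ∩ Y) + comps (addAll Y X L) ≡⟨ +-comm (comps (X ∩ Y)) _ ⟩
    comps (addAll Y X L) + comps (X ∩ Y) ≡⟨ cong (_+ comps (X ∩ Y)) (comps-cong (λ e → trans (addAll-all Y X e) (∨-comm (Y e) (X e)))) ⟩
    comps (X ∪ Y) + comps (X ∩ Y) ∎
    where
    open ≤-Reasoning
    L : List E
    L = allFin (m G)
    absorb : ∀ a b → (a ∧ b) ∨ a ≡ a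
    absorb true true = refl
    absorb true false = refl
    absorb false b = refl

-- Truth-table identities for moving one edge.

∀Bool? : ∀ {P : Bool → Set} → (∀ b → Dec (P b)) → Dec (∀ b → P b)
∀Bool? P? = map′ (λ (t , f) → λ { true → t ; false → f }) (λ p → p true , p false) (P? true ×-dec P? false)

infix 4 _==_
_==_ : (a b : Bool) → Dec (a ≡ b)
_==_ = Bool._≟_

-- In these identities a, b, u, f are the values at one edge of sets A, B, U, F, and x says whether it is the edge being moved.

join-sets : ∀ a b u f x → (x ≡ true → u ≡ true) →
  (a ∧ (u ∧ not x) ∨ (f ∨ x)) ∨ (b ∧ (u ∧ not x) ∨ f) ≡ (((a ∨ b) ∨ x) ∧ u) ∨ f
join-sets = toWitness {a? = ∀Bool? λ a → ∀Bool? λ b → ∀Bool? λ u → ∀Bool? λ f → ∀Bool? λ x →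
  ((x == true) →-dec (u == true)) →-dec (_ == _)} _

join-setsʳ : ∀ a b u f x → (x ≡ true → u ≡ true) →
  (a ∧ (u ∧ not x) ∨ f) ∨ (b ∧ (u ∧ not x) ∨ (f ∨ x)) ≡ (((a ∨ b) ∨ x) ∧ u) ∨ f
join-setsʳ = toWitness {a? = ∀Bool? λ a → ∀Bool? λ b → ∀Bool? λ u → ∀Bool? λ f → ∀Bool? λ x →
  ((x == true) →-dec (u == true)) →-dec (_ == _)} _

meet-sets : ∀ a b u f x → (x ≡ true → f ≡ false) →
  (a ∧ (u ∧ not x) ∨ (f ∨ x)) ∧ (b ∧ (u ∧ not x) ∨ f) ≡ (((a ∧ b) ∧ not x) ∧ u) ∨ f
meet-sets = toWitness {a? = ∀Bool? λ a → ∀Bool? λ b → ∀Bool? λ u → ∀Bool? λ f → ∀Bool? λ x →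
  ((x == true) →-dec (f == false)) →-dec (_ == _)} _

meet-setsʳ : ∀ a b u f x → (x ≡ true → f ≡ false) →
  (a ∧ (u ∧ not x) ∨ f) ∧ (b ∧ (u ∧ not x) ∨ (f ∨ x)) ≡ (((a ∧ b) ∧ not x) ∧ u) ∨ f
meet-setsʳ = toWitness {a? = ∀Bool? λ a → ∀Bool? λ b → ∀Bool? λ u → ∀Bool? λ f → ∀Bool? λ x →
  ((x == true) →-dec (f == false)) →-dec (_ == _)} _

count-sets : ∀ a b u x → (x ≡ true → u ≡ true) →
  b2n (u ∧ not ((a ∨ b) ∨ x)) + b2n (u ∧ not ((a ∧ b) ∧ not x)) ≡
  (b2n ((u ∧ not x) ∧ not a) + b2n ((u ∧ not x) ∧ not b)) + b2n x
count-sets = toWitness {a? = ∀Bool? λ a → ∀Bool? λ b → ∀Bool? λ u → ∀Bool? λ x →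
  ((x == true) →-dec (u == true)) →-dec (_ ℕ.≟ _)} _

-- Two spanning edge sets that overlap only in contracted edges.

module Packing (G : Graph) where
  open Cuts G
  open Components G

  full : ES
  full _ = true

  r : ℕ
  r = comps full

  infixl 7 _∖_
  _∖_ : ES → ES → ES
  (U ∖ A) e = U e ∧ not (A e)

  -- The Nash-Williams condition for distributing the edges of U between E₁ and E₂.
  Room : ES → ES → ES → Set
  Room U E₁ E₂ = ∀ A → comps (A ∩ U ∪ E₁) + comps (A ∩ U ∪ E₂) ≤ count (U ∖ A) + (r + r)

  room-resp : ∀ U E₁ E₂ → Resp λ A → comps (A ∩ U ∪ E₁) + comps (A ∩ U ∪ E₂) ≤ count (U ∖ A) + (r + r)
  room-resp U E₁ E₂ p = subst₂ _≤_
    (cong₂ _+_ (comps-cong (λ e → cong (λ a → a ∧ U e ∨ E₁ e) (p e))) (comps-cong (λ e → cong (λ a → a ∧ U e ∨ E₂ e) (p e))))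
    (cong (_+ (r + r)) (count-cong (λ e → cong (λ a → U e ∧ not a) (p e))))

  room-or : ∀ U E₁ E₂ → Room U E₁ E₂ ⊎
    Σ ES λ A → suc (count (U ∖ A) + (r + r)) ≤ comps (A ∩ U ∪ E₁) + comps (A ∩ U ∪ E₂)
  room-or U E₁ E₂ = decide (search {P = Bad} bad-resp (λ A → _ ≤? _))
    where
    Bad : ES → Set
    Bad A = suc (count (U ∖ A) + (r + r)) ≤ comps (A ∩ U ∪ E₁) + comps (A ∩ U ∪ E₂)
    bad-resp : Resp Bad
    bad-resp {A} {B} p bad = ≰⇒> λ ok → <⇒≱ bad (room-resp U E₁ E₂ (λ e → sym (p e)) ok)
    decide : Dec (Σ ES Bad) → Room U E₁ E₂ ⊎ Σ ES Bad
    decide (yes bad) = inj₂ bad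
    decide (no none) = inj₁ λ A → ≮⇒≥ λ bad → none (A , bad)

  module _ (U E₁ E₂ : ES) (x : E) (Ux : U x ≡ true) (E₁x : E₁ x ≡ false) (E₂x : E₂ x ≡ false) (room : Room U E₁ E₂) where

    U′ : ES
    U′ = U ∖ eqB x

    only : ∀ {P : ES} {b} → P x ≡ b → ∀ e → eqB x e ≡ true → P e ≡ b
    only {P} {b} p e q = subst (λ f → P f ≡ b) (eqB-true x e q) p

    -- If A obstructs giving x to E₁ and B obstructs giving it to E₂, then by
    -- supermodularity A ∪ B ∪ x and A ∩ B cannot both satisfy the condition.
    clash : ∀ A B →
      suc (count (U′ ∖ A) + (r + r)) ≤ comps (A ∩ U′ ∪ add E₁ x) + comps (A ∩ U′ ∪ E₂) →
      suc (count (U′ ∖ B) + (r + r)) ≤ comps (B ∩ U′ ∪ E₁) + comps (B ∩ U′ ∪ add E₂ x) → ⊥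
    clash A B badA badB = 1+n≰n (begin
      suc ((cA + cB + 1) + (R + R)) ≡⟨ shuffle₁ cA cB R ⟩
      suc (cA + R) + suc (cB + R) ≤⟨ +-mono-≤ badA badB ⟩
      (a₁ + a₂) + (b₁ + b₂) ≡⟨ interchange a₁ a₂ b₁ b₂ ⟩
      (a₁ + b₁) + (a₂ + b₂) ≤⟨ +-mono-≤ super₁ super₂ ⟩
      (p₁ + q₁) + (p₂ + q₂) ≡⟨ interchange p₁ q₁ p₂ q₂ ⟩
      (p₁ + p₂) + (q₁ + q₂) ≤⟨ +-mono-≤ (room P) (room Q) ⟩
      (count (U ∖ P) + R) + (count (U ∖ Q) + R) ≡⟨ interchange (count (U ∖ P)) R (count (U ∖ Q)) R ⟩
      (count (U ∖ P) + count (U ∖ Q)) + (R + R) ≡⟨ cong (_+ (R + R)) counts ⟩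
      (cA + cB + 1) + (R + R) ∎)
      where
      open ≤-Reasoning
      P Q : ES
      P = (A ∪ B) ∪ eqB x
      Q = (A ∩ B) ∖ eqB x
      R cA cB a₁ a₂ b₁ b₂ p₁ p₂ q₁ q₂ : ℕ
      R = r + r
      cA = count (U′ ∖ A)
      cB = count (U′ ∖ B)
      a₁ = comps (A ∩ U′ ∪ add E₁ x)
      a₂ = comps (A ∩ U′ ∪ E₂)
      b₁ = comps (B ∩ U′ ∪ E₁)
      b₂ = comps (B ∩ U′ ∪ add E₂ x)
      p₁ = comps (P ∩ U ∪ E₁)
      p₂ = comps (P ∩ U ∪ E₂)
      q₁ = comps (Q ∩ U ∪ E₁)
      q₂ = comps (Q ∩ U ∪ E₂)
      shuffle₁ : ∀ a b c → suc ((a + b + 1) + (c + c)) ≡ suc (a + c) + suc (b + c)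
      shuffle₁ = solve 3 (λ a b c → con 1 :+ ((a :+ b :+ con 1) :+ (c :+ c)) := (con 1 :+ (a :+ c)) :+ (con 1 :+ (b :+ c))) refl
        where open +-*-Solver
      super₁ : a₁ + b₁ ≤ p₁ + q₁
      super₁ = ≤-trans (comps-supermodular (A ∩ U′ ∪ add E₁ x) (B ∩ U′ ∪ E₁)) (≤-reflexive (cong₂ _+_
        (comps-cong (λ e → join-sets (A e) (B e) (U e) (E₁ e) (eqB x e) (only {U} Ux e)))
        (comps-cong (λ e → meet-sets (A e) (B e) (U e) (E₁ e) (eqB x e) (only {E₁} E₁x e)))))
      super₂ : a₂ + b₂ ≤ p₂ + q₂
      super₂ = ≤-trans (comps-supermodular (A ∩ U′ ∪ E₂) (B ∩ U′ ∪ add E₂ x)) (≤-reflexive (cong₂ _+_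
        (comps-cong (λ e → join-setsʳ (A e) (B e) (U e) (E₂ e) (eqB x e) (only {U} Ux e)))
        (comps-cong (λ e → meet-setsʳ (A e) (B e) (U e) (E₂ e) (eqB x e) (only {E₂} E₂x e)))))
      counts : count (U ∖ P) + count (U ∖ Q) ≡ cA + cB + 1
      counts = trans (sym (sum-+ (b2n ∘ (U ∖ P)) (b2n ∘ (U ∖ Q))))
        (trans (sum-cong (λ e → count-sets (A e) (B e) (U e) (eqB x e) (only {U} Ux e)))
        (trans (sum-+ (λ e → b2n ((U′ ∖ A) e) + b2n ((U′ ∖ B) e)) (λ e → b2n (eqB x e)))
        (cong₂ _+_ (sum-+ (λ e → b2n ((U′ ∖ A) e)) (λ e → b2n ((U′ ∖ B) e))) (count-eqB x))))

    assign : Room U′ (add E₁ x) E₂ ⊎ Room U′ E₁ (add E₂ x)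
    assign with room-or U′ (add E₁ x) E₂ | room-or U′ E₁ (add E₂ x)
    ... | inj₁ ok | _ = inj₁ ok
    ... | inj₂ _ | inj₁ ok = inj₂ ok
    ... | inj₂ (A , badA) | inj₂ (B , badB) = ⊥-elim (clash A B badA badB)

  -- The edges of `A` are to be contracted, so both sets may use them.
  Disjoint : ES → ES → ES → Set
  Disjoint A E₁ E₂ = ∀ e → E₁ e ≡ true → E₂ e ≡ true → A e ≡ true

  -- `U` holds the undecided edges and `b` bounds their number. When none is left, the condition at
  -- `∅` is the claimed bound; as each count is at least `r`, both sets are then spanning.
  distribute : ∀ A b U E₁ E₂ → count U < b → (∀ e → U e ≡ true → E₁ e ≡ false) → (∀ e → U e ≡ true → E₂ e ≡ false) →
    Disjoint A E₁ E₂ → Room U E₁ E₂ → Σ ES λ E₁′ → Σ ES λ E₂′ → Disjoint A E₁′ E₂′ × comps E₁′ + comps E₂′ ≤ r + r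
  distribute A (suc b) U E₁ E₂ lt d₁ d₂ dis room = cases (any? (λ x → U x Bool.≟ true))
    where
    cases : Dec (∃[ x ] U x ≡ true) → Σ ES λ E₁′ → Σ ES λ E₂′ → Disjoint A E₁′ E₂′ × comps E₁′ + comps E₂′ ≤ r + r
    cases (no none) = E₁ , E₂ , dis , subst₂ _≤_ refl (cong (_+ (r + r)) (count-empty λ e → cong (_∧ true) (U-false e))) (room ∅)
      where
      U-false : ∀ e → U e ≡ false
      U-false e = ≢true λ p → none (e , p)
    cases (yes (x , Ux)) = choose (assign U E₁ E₂ x Ux (d₁ x Ux) (d₂ x Ux) room)
      where
      V′ : ES
      V′ = U ∖ eqB x
      V′⊆U : V′ ⊆ U
      V′⊆U e p = proj₁ (∧-true {U e} p)
      V′-x : ∀ {e} → V′ e ≡ true → eqB x e ≡ false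
      V′-x {e} p = not-true (proj₂ (∧-true {U e} p))
      smaller′ : count V′ < b
      smaller′ = <-≤-trans (count-strict V′⊆U x (cong₂ (λ a c → a ∧ not c) Ux (eqB-refl x)) Ux) (s≤s⁻¹ lt)
      avoid : ∀ {F} → (∀ e → U e ≡ true → F e ≡ false) → ∀ e → V′ e ≡ true → add F x e ≡ false
      avoid d e p = cong₂ _∨_ (d e (V′⊆U e p)) (V′-x p)
      at-x : ∀ {F} → F x ≡ false → ∀ e → F e ≡ true → eqB x e ≡ true → ⊥
      at-x {F} Fx e Fe q = true≢false (subst (λ f → F f ≡ true) (sym (eqB-true x e q)) Fe) Fx
      dis₁ : Disjoint A (add E₁ x) E₂
      dis₁ e p q with ∨-true {E₁ e} p
      ... | inj₁ p′ = dis e p′ q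
      ... | inj₂ p′ = ⊥-elim (at-x {E₂} (d₂ x Ux) e q p′)
      dis₂ : Disjoint A E₁ (add E₂ x)
      dis₂ e p q with ∨-true {E₂ e} q
      ... | inj₁ q′ = dis e p q′
      ... | inj₂ q′ = ⊥-elim (at-x {E₁} (d₁ x Ux) e p q′)
      choose : Room V′ (add E₁ x) E₂ ⊎ Room V′ E₁ (add E₂ x) →
        Σ ES λ E₁′ → Σ ES λ E₂′ → Disjoint A E₁′ E₂′ × comps E₁′ + comps E₂′ ≤ r + r
      choose (inj₁ ok) = distribute A b V′ (add E₁ x) E₂ smaller′ (avoid d₁) (λ e p → d₂ e (V′⊆U e p)) dis₁ ok
      choose (inj₂ ok) = distribute A b V′ E₁ (add E₂ x) smaller′ (λ e p → d₁ e (V′⊆U e p)) (avoid d₂) dis₂ ok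

  Spanning : ES → Set
  Spanning A = ∀ e → conn A (end₁ G e) (end₂ G e) ≡ true

  -- An edge between two components of `A` would push the count below that of the whole graph.
  spanning : ∀ A → comps A ≤ r → Spanning A
  spanning A le e with bool-cases (conn A (end₁ G e) (end₂ G e))
  ... | inj₁ c = c
  ... | inj₂ sep = contradiction (begin
    suc (comps (add A e)) ≤⟨ comps-separate A e sep ⟩
    comps A ≤⟨ le ⟩
    comps full ≤⟨ comps-mono {add A e} {full} (λ _ _ → refl) ⟩
    comps (add A e) ∎) 1+n≰n
    where open ≤-Reasoning

  r≤comps : ∀ A → r ≤ comps A
  r≤comps A = comps-mono {A} {full} (λ _ _ → refl)

  -- The edges outside A, each closed up to a circuit inside A.
  cocycle : ∀ A → Spanning A → Σ ES λ X → Cycle X × (∀ e → A e ≡ false → X e ≡ true)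
  cocycle A span = X , cycle X-cycle , X-outside
    where
    z : E → ES
    z e = proj₁ (conn-join A (end₁ G e) (end₂ G e) (span e))
    z⊆A : ∀ e → z e ⊆ A
    z⊆A e = proj₁ (proj₂ (conn-join A (end₁ G e) (end₂ G e) (span e)))
    z-join : ∀ e → Join (z e) (end₁ G e) (end₂ G e)
    z-join e = proj₂ (proj₂ (conn-join A (end₁ G e) (end₂ G e) (span e)))
    X : ES
    X f = xsum (λ e → not (A e) ∧ (eqB e f xor z e f))
    circuit : ∀ e S → dot (eqB e ⊕ z e) S ≡ false
    circuit e S = even-cut (Join-loop (Join-trans (Join-edge e) (Join-sym (z-join e)))) S
    X-cycle : ∀ S → dot X S ≡ false
    X-cycle S = begin
      xsum (λ f → X f ∧ δ S f) ≡⟨ xsum-cong (λ f → trans (∧-comm (X f) (δ S f)) (sym (xsum-∧ (δ S f) (λ e → not (A e) ∧ (eqB e f xor z e f))))) ⟩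
      xsum (λ f → xsum (λ e → δ S f ∧ (not (A e) ∧ (eqB e f xor z e f)))) ≡⟨ xsum-swap (λ f e → δ S f ∧ (not (A e) ∧ (eqB e f xor z e f))) ⟩
      xsum (λ e → xsum (λ f → δ S f ∧ (not (A e) ∧ (eqB e f xor z e f)))) ≡⟨ xsum-cong (λ e →
        trans (xsum-cong (λ f → swap-∧ (δ S f) (not (A e)) (eqB e f xor z e f))) (xsum-∧ (not (A e)) (λ f → (eqB e f xor z e f) ∧ δ S f))) ⟩
      xsum (λ e → not (A e) ∧ dot (eqB e ⊕ z e) S) ≡⟨ xsum-false (λ e → trans (cong (not (A e) ∧_) (circuit e S)) (∧-zeroʳ (not (A e)))) ⟩
      false ∎
      where
      open ≡-Reasoning
      swap-∧ : ∀ a b c → a ∧ (b ∧ c) ≡ b ∧ (c ∧ a)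
      swap-∧ true b c = cong (b ∧_) (sym (∧-identityʳ c))
      swap-∧ false true true = refl
      swap-∧ false true false = refl
      swap-∧ false false c = refl
    -- The closing paths `z` stay inside `A`, so `f` occurs only in its own circuit.
    X-outside : ∀ f → A f ≡ false → X f ≡ true
    X-outside f Af = trans (xsum-cong pointwise) (trans (xsum-eqB f (λ e → not (A e))) (cong not Af))
      where
      pointwise : ∀ e → not (A e) ∧ (eqB e f xor z e f) ≡ eqB f e ∧ not (A e)
      pointwise e = trans (cong (not (A e) ∧_) (trans (cong (eqB e f xor_) (⊆-false (z⊆A e) Af)) (xor-identityʳ (eqB e f))))
        (trans (∧-comm (not (A e)) (eqB e f)) (cong (_∧ not (A e)) (eqB-sym e f)))

count-two : ∀ {k} (P : Fin k → Bool) → count P ≡ 2 → ∀ f → P f ≡ true →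
  ∃[ g ] P g ≡ true × (∀ e → P e ≡ eqB f e xor eqB g e)
count-two P two f Pf = g , proj₁ (∧-true P′g) , λ e → split e
  where
  P′ : _ → Bool
  P′ e = P e ∧ not (eqB f e)
  decompose : ∀ e → b2n (P e) ≡ b2n (P′ e) + b2n (eqB f e)
  decompose e = pointwise (P e) (eqB f e) (eqB-⊆ {P = P} Pf e)
    where
    pointwise : ∀ a b → (b ≡ true → a ≡ true) → b2n a ≡ b2n (a ∧ not b) + b2n b
    pointwise true true _ = refl
    pointwise true false _ = refl
    pointwise false true p = contradiction (p refl) λ ()
    pointwise false false _ = refl
  one : count P′ ≡ 1
  one = +-cancelʳ-≡ 1 _ _ (begin
    count P′ + 1 ≡⟨ cong (count P′ +_) (sym (count-eqB f)) ⟩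
    count P′ + count (eqB f) ≡⟨ sym (sum-+ (b2n ∘ P′) (b2n ∘ eqB f)) ⟩
    sumℕ (λ e → b2n (P′ e) + b2n (eqB f e)) ≡⟨ sum-cong (λ e → sym (decompose e)) ⟩
    count P ≡⟨ two ⟩
    2 ∎)
    where open ≡-Reasoning
  found : ∃[ g ] P′ g ≡ true
  found = count-witness P′ (≤-reflexive (sym one))
  g = proj₁ found
  P′g : P′ g ≡ true
  P′g = proj₂ found
  split : ∀ e → P e ≡ eqB f e xor eqB g e
  split e with f ≟ e
  ... | yes refl = trans Pf (sym (cong not (eqB-≢ λ g≡f → true≢false P′g
      (trans (cong (λ h → P g ∧ not h) (trans (cong (eqB f) g≡f) (eqB-refl f))) (∧-zeroʳ (P g))))))
  ... | no f≢e = bool-ext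
    (λ Pe → subst (λ h → eqB g h ≡ true) (count-one P′ one g e P′g (cong₂ (λ a b → a ∧ not b) Pe (eqB-≢ f≢e))) (eqB-refl g))
    (λ q → subst (λ h → P h ≡ true) (eqB-true g e q) (proj₁ (∧-true P′g)))

-- Nowhere-zero flows in contracted graphs without cuts of size 1 or 3.

module Flows (G : Graph) where
  open Cuts G
  open Components G
  open Packing G

  closed? : ∀ A S → Dec (Closed A S)
  closed? A S = all? (λ e → (A e Bool.≟ true) →-dec (δ S e Bool.≟ false))

  Closed-resp : ∀ A → Resp (Closed A)
  Closed-resp A p c e q = trans (sym (δ-cong p e)) (c e q)

  -- A nowhere-zero flow in G / A, given by its two coordinates X and Y.
  Flow : ES → Set
  Flow A = Σ ES λ X → Σ ES λ Y → (∀ e → A e ≡ false → X e ∨ Y e ≡ true) ×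
    (∀ S → Closed A S → dot X S ≡ false × dot Y S ≡ false)

  -- With cuts of size 0 or at least 4, counting the edges leaving each component gives the
  -- Nash-Williams condition.
  module FourEdgeConnected (A : ES) (big : ∀ S → Closed A S → count (δ S) ≢ 0 → 4 ≤ count (δ S)) where

    module _ (B : ES) (A⊆B : A ⊆ B) where

      edges-out : V → ℕ
      edges-out v = if least B v then count (δ (conn B v)) else 0

      -- A component of `B` that no edge leaves is a component of `G`, and its least vertex is
      -- counted in `r`. Any other component is left by at least four edges.
      four : ∀ v → 4 * b2n (least B v) ≤ edges-out v + 4 * b2n (least full v)
      four v with bool-cases (least B v)
      ... | inj₂ l rewrite l = z≤n
      ... | inj₁ l rewrite l with count (δ (conn B v)) ℕ.≟ 0
      ...   | no nz = ≤-trans (big (conn B v) (λ e p → conn-Closed B v e (A⊆B e p)) nz) (m≤m+n _ _)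
      ...   | yes z = ≤-trans (≤-reflexive (cong (λ b → 4 * b2n b) (sym l-full))) (m≤n+m _ (count (δ (conn B v))))
        where
        whole : Closed full (conn B v)
        whole e _ = ≢true λ p → contradiction (≤-trans (count-pos (δ (conn B v)) e p) (≤-reflexive z)) 1+n≰n
        l-full : least full v ≡ true
        l-full with bool-cases (least full v)
        ... | inj₁ p = p
        ... | inj₂ p = let (u , lt , c) = least-not full v p in
          ⊥-elim (least-out B l lt (conn-sym B (trans (conn-least full (conn B v) whole c) (conn-refl B v))))

      ends-count : ∀ u → count (λ v → least B v ∧ conn B v u) ≤ 1
      ends-count u = count-unique _ λ v v′ p q →
        least-unique B v v′ (proj₁ (∧-true p)) (proj₁ (∧-true q))
          (conn-trans B (proj₂ (∧-true {least B v} p)) (conn-sym B (proj₂ (∧-true {least B v′} q))))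

      -- An edge of `B` leaves no component of `B`, and any other edge has only two ends to leave
      -- from.
      twice : ∀ e → sumℕ (λ v → if least B v then b2n (δ (conn B v) e) else 0) ≤ 2 * b2n (not (B e))
      twice e with bool-cases (B e)
      ... | inj₁ Be = ≤-trans (≤-reflexive (trans (sum-cong (λ v → null (least B v) (conn-Closed B v e Be))) (sum-0 (n G)))) z≤n
        where
        null : ∀ a {b} → b ≡ false → (if a then b2n b else 0) ≡ 0
        null true refl = refl
        null false _ = refl
      ... | inj₂ Be = begin
        sumℕ (λ v → if least B v then b2n (δ (conn B v) e) else 0) ≤⟨ sum-mono (λ v → pointwise (least B v) (conn B v (end₁ G e)) (conn B v (end₂ G e))) ⟩
        sumℕ (λ v → b2n (least B v ∧ conn B v (end₁ G e)) + b2n (least B v ∧ conn B v (end₂ G e))) ≡⟨ sum-+ (λ v → b2n (least B v ∧ conn B v (end₁ G e))) (λ v → b2n (least B v ∧ conn B v (end₂ G e))) ⟩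
        count (λ v → least B v ∧ conn B v (end₁ G e)) + count (λ v → least B v ∧ conn B v (end₂ G e)) ≤⟨ +-mono-≤ (ends-count _) (ends-count _) ⟩
        2 ≡⟨ cong (λ b → 2 * b2n (not b)) (sym Be) ⟩
        2 * b2n (not (B e)) ∎
        where
        open ≤-Reasoning
        pointwise : ∀ l a b → (if l then b2n (a xor b) else 0) ≤ b2n (l ∧ a) + b2n (l ∧ b)
        pointwise false a b = z≤n
        pointwise true true b = ≤-trans (b2n≤1 (not b)) (s≤s z≤n)
        pointwise true false b = ≤-refl

      edges-out-sum : sumℕ edges-out ≤ 2 * count (not ∘ B)
      edges-out-sum = begin
        sumℕ edges-out ≡⟨ sum-cong (λ v → pull (least B v) (λ e → b2n (δ (conn B v) e))) ⟩
        sumℕ (λ v → sumℕ (λ e → if least B v then b2n (δ (conn B v) e) else 0)) ≡⟨ sum-swap (λ v e → if least B v then b2n (δ (conn B v) e) else 0) ⟩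
        sumℕ (λ e → sumℕ (λ v → if least B v then b2n (δ (conn B v) e) else 0)) ≤⟨ sum-mono twice ⟩
        sumℕ (λ e → 2 * b2n (not (B e))) ≡⟨ sum-* 2 (λ e → b2n (not (B e))) ⟩
        2 * count (not ∘ B) ∎
        where
        open ≤-Reasoning
        pull : ∀ {k} b (f : Fin k → ℕ) → (if b then sumℕ f else 0) ≡ sumℕ (λ i → if b then f i else 0)
        pull true f = refl
        pull {k} false f = sym (sum-0 k)

      component-bound : comps B + comps B ≤ count (not ∘ B) + (r + r)
      component-bound = *-cancelˡ-≤ 2 (begin
        2 * (comps B + comps B) ≡⟨ double (comps B) ⟩
        4 * comps B ≡⟨ sym (sum-* 4 (λ v → b2n (least B v))) ⟩
        sumℕ (λ v → 4 * b2n (least B v)) ≤⟨ sum-mono four ⟩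
        sumℕ (λ v → edges-out v + 4 * b2n (least full v)) ≡⟨ sum-+ edges-out (λ v → 4 * b2n (least full v)) ⟩
        sumℕ edges-out + sumℕ (λ v → 4 * b2n (least full v)) ≤⟨ +-mono-≤ edges-out-sum (≤-reflexive (sum-* 4 (λ v → b2n (least full v)))) ⟩
        2 * count (not ∘ B) + 4 * r ≡⟨ cong (2 * count (not ∘ B) +_) (sym (double r)) ⟩
        2 * count (not ∘ B) + 2 * (r + r) ≡⟨ sym (*-distribˡ-+ 2 (count (not ∘ B)) (r + r)) ⟩
        2 * (count (not ∘ B) + (r + r)) ∎)
        where
        open ≤-Reasoning
        double : ∀ k → 2 * (k + k) ≡ 4 * k
        double = solve 1 (λ k → con 2 :* (k :+ k) := con 4 :* k) refl
          where open +-*-Solver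

    -- Starting from `A` on both sides, the two component counts in the condition are those of one
    -- set `B`, so `component-bound` applies.
    room : Room (not ∘ A) A A
    room X = ≤-trans (component-bound B (λ e p → ∨-trueʳ (X e ∧ not (A e)) p))
      (≤-reflexive (cong (_+ (r + r)) (count-cong (λ e → pointwise (X e) (A e)))))
      where
      B : ES
      B = X ∩ (not ∘ A) ∪ A
      pointwise : ∀ x a → not (x ∧ not a ∨ a) ≡ not a ∧ not x
      pointwise true true = refl
      pointwise true false = refl
      pointwise false true = refl
      pointwise false false = refl

    flow : Flow A
    flow =
      let (E₁ , E₂ , dis , le) = distribute A _ (not ∘ A) A A ≤-refl (λ e → not-true) (λ e → not-true) (λ _ p _ → p) room
          (X , cX , oX) = cocycle E₁ (spanning E₁ (+-cancelʳ-≤ r _ _ (≤-trans (+-monoʳ-≤ (comps E₁) (r≤comps E₂)) le)))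
          (Y , cY , oY) = cocycle E₂ (spanning E₂ (+-cancelˡ-≤ r _ _ (≤-trans (+-monoˡ-≤ (comps E₂) (r≤comps E₁)) le)))
      in X , Y , (λ e Ae → nonzero (E₁ e) (E₂ e) (oX e) (oY e) (λ p q → true≢false (dis e p q) Ae)) ,
         λ S _ → even-cut cX S , even-cut cY S
      where
      nonzero : ∀ {x y} a b → (a ≡ false → x ≡ true) → (b ≡ false → y ≡ true) → (a ≡ true → b ≡ true → ⊥) → x ∨ y ≡ true
      nonzero true true _ _ d = ⊥-elim (d refl refl)
      nonzero {x} true false _ p _ = ∨-trueʳ x (p refl)
      nonzero {_} {y} false b p _ _ = ∨-trueˡ y (p refl)

  -- In a 2-cut {f , g} of G / A the flow on f is that on g.
  module TwoCut (A : ES) (S₀ : VS) (closed₀ : Closed A S₀) (two : count (δ S₀) ≡ 2) where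

    f g : E
    f = proj₁ (count-witness (δ S₀) (≤-trans (s≤s z≤n) (≤-reflexive (sym two))))
    f∈ : δ S₀ f ≡ true
    f∈ = proj₂ (count-witness (δ S₀) (≤-trans (s≤s z≤n) (≤-reflexive (sym two))))
    g = proj₁ (count-two (δ S₀) two f f∈)
    g∈ : δ S₀ g ≡ true
    g∈ = proj₁ (proj₂ (count-two (δ S₀) two f f∈))
    δ₀ : ∀ e → δ S₀ e ≡ eqB f e xor eqB g e
    δ₀ = proj₂ (proj₂ (count-two (δ S₀) two f f∈))

    f≢g : f ≢ g
    f≢g f≡g = true≢false f∈ (trans (δ₀ f) (cong₂ _xor_ (eqB-refl f) (trans (cong (λ h → eqB h f) (sym f≡g)) (eqB-refl f))))

    off : ∀ {e} → δ S₀ e ≡ true → A e ≡ false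
    off p = ≢true λ q → true≢false p (closed₀ _ q)

    smaller-rest : count (not ∘ add A f) < count (not ∘ A)
    smaller-rest = count-strict (λ e p → cong not (∨-falseˡ (A e) (not-true p))) f
      (cong not (∈-add A f)) (cong not (off f∈))
      where
      ∨-falseˡ : ∀ a {b} → a ∨ b ≡ false → a ≡ false
      ∨-falseˡ false _ = refl

    extend : ES → ES
    extend X e = if eqB f e then X g else X e

    extend-off : ∀ X {e} → eqB f e ≡ false → extend X e ≡ X e
    extend-off X p = cong (λ b → if b then X g else X _) p

    extend-f : ∀ X → extend X f ≡ X g
    extend-f X = cong (λ b → if b then X g else X f) (eqB-refl f)

    extend-g : ∀ X → extend X g ≡ X g
    extend-g X = extend-off X (eqB-≢ f≢g)

    dot-S₀ : ∀ X → dot (extend X) S₀ ≡ false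
    dot-S₀ X = begin
      xsum (λ e → extend X e ∧ δ S₀ e) ≡⟨ xsum-cong (λ e → trans (cong (extend X e ∧_) (δ₀ e)) (distrib (extend X e) (eqB f e) (eqB g e))) ⟩
      xsum (λ e → (eqB f e ∧ extend X e) xor (eqB g e ∧ extend X e)) ≡⟨ xsum-xor (λ e → eqB f e ∧ extend X e) (λ e → eqB g e ∧ extend X e) ⟩
      xsum (λ e → eqB f e ∧ extend X e) xor xsum (λ e → eqB g e ∧ extend X e) ≡⟨ cong₂ _xor_ (trans (xsum-eqB f (extend X)) (extend-f X)) (trans (xsum-eqB g (extend X)) (extend-g X)) ⟩
      X g xor X g ≡⟨ xor-same (X g) ⟩
      false ∎
      where
      open ≡-Reasoning
      distrib : ∀ a b c → a ∧ (b xor c) ≡ (b ∧ a) xor (c ∧ a)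
      distrib a b c = trans (∧-distribˡ-xor a b c) (cong₂ _xor_ (∧-comm a b) (∧-comm a c))

    module _ (X : ES) (orth : ∀ S → Closed (add A f) S → dot X S ≡ false) where

      uncut : ∀ S → Closed A S → δ S f ≡ false → dot (extend X) S ≡ false
      uncut S c δf = trans (xsum-cong same) (orth S (Closed-add A f S c δf))
        where
        same : ∀ e → extend X e ∧ δ S e ≡ X e ∧ δ S e
        same e with bool-cases (eqB f e)
        ... | inj₂ p = cong (_∧ δ S e) (extend-off X p)
        ... | inj₁ p = trans (cong (extend X e ∧_) δe) (trans (∧-zeroʳ _) (sym (trans (cong (X e ∧_) δe) (∧-zeroʳ _))))
          where
          δe : δ S e ≡ false
          δe = subst (λ h → δ S h ≡ false) (eqB-true f e p) δf

      -- If `S` cuts `f`, then `S ⊕ S₀` does not, so it is a cut of the smaller graph. The sum over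
      -- the cut of `S₀` itself is the value on `g` taken twice, hence zero.
      extend-orth : ∀ S → Closed A S → dot (extend X) S ≡ false
      extend-orth S c with bool-cases (δ S f)
      ... | inj₂ p = uncut S c p
      ... | inj₁ p = begin
        dot (extend X) S ≡⟨ sym (xor-identityʳ _) ⟩
        dot (extend X) S xor false ≡⟨ cong (dot (extend X) S xor_) (sym (dot-S₀ X)) ⟩
        dot (extend X) S xor dot (extend X) S₀ ≡⟨ sym (dot-⊕ʳ (extend X) S S₀) ⟩
        dot (extend X) (S ⊕ S₀) ≡⟨ uncut (S ⊕ S₀) (λ e q → trans (δ-⊕ S S₀ e) (cong₂ _xor_ (c e q) (closed₀ e q))) (trans (δ-⊕ S S₀ f) (cong₂ _xor_ p f∈)) ⟩
        false ∎
        where open ≡-Reasoning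

    extend-flow : Flow (add A f) → Flow A
    extend-flow (X , Y , nz , orth) = extend X , extend Y , nonzero , λ S c →
        extend-orth X (λ S c → proj₁ (orth S c)) S c , extend-orth Y (λ S c → proj₂ (orth S c)) S c
      where
      nonzero : ∀ e → A e ≡ false → extend X e ∨ extend Y e ≡ true
      nonzero e Ae with bool-cases (eqB f e)
      ... | inj₂ p = trans (cong₂ _∨_ (extend-off X p) (extend-off Y p)) (nz e (cong₂ _∨_ Ae p))
      ... | inj₁ p = subst (λ h → extend X h ∨ extend Y h ≡ true) (eqB-true f e p)
        (trans (cong₂ _∨_ (extend-f X) (extend-f Y)) (nz g (cong₂ _∨_ (off g∈) (eqB-≢ f≢g))))

  -- Sets closed for a larger `A` are closed for the smaller one, so contraction creates no new cuts
  -- and the hypothesis survives each step.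
  four-flow : ∀ b A → count (not ∘ A) < b →
    (∀ S → Closed A S → count (δ S) ≢ 1 × count (δ S) ≢ 3) → Flow A
  four-flow (suc b) A lt no-odd = cases (search {P = λ S → Closed A S × count (δ S) ≡ 2}
      (λ p (c , q) → Closed-resp A p c , trans (sym (count-cong (δ-cong p))) q)
      (λ S → closed? A S ×-dec (count (δ S) ℕ.≟ 2)))
    where
    cases : Dec (Σ VS λ S → Closed A S × count (δ S) ≡ 2) → Flow A
    cases (yes (S , c , two)) = T.extend-flow (four-flow b (add A T.f) (<-≤-trans T.smaller-rest (s≤s⁻¹ lt))
        (λ S′ c′ → no-odd S′ (λ e p → c′ e (⊆-add A T.f e p))))
      where module T = TwoCut A S c two
    cases (no none) = FourEdgeConnected.flow A λ S c nz →
        at-least (count (δ S)) nz (proj₁ (no-odd S c)) (λ two → none (S , c , two)) (proj₂ (no-odd S c))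
      where
      at-least : ∀ k → k ≢ 0 → k ≢ 1 → k ≢ 2 → k ≢ 3 → 4 ≤ k
      at-least 0 a _ _ _ = contradiction refl a
      at-least 1 _ a _ _ = contradiction refl a
      at-least 2 _ _ a _ = contradiction refl a
      at-least 3 _ _ _ a = contradiction refl a
      at-least (suc (suc (suc (suc k)))) _ _ _ _ = s≤s (s≤s (s≤s (s≤s z≤n)))

-- From the two coordinates to a non-conflicting flow.

sumK-xsum : ∀ {k} (f : Fin k → K) → sumK f ≡ (xsum (proj₁ ∘ f) , xsum (proj₂ ∘ f))
sumK-xsum {zero} f = refl
sumK-xsum {suc k} f = cong (f zero +K_) (sumK-xsum (λ i → f (suc i)))

ends-sum : ∀ a b x y → (if a then (x , y) else 0K) +K (if b then (x , y) else 0K) ≡ (x ∧ (a xor b) , y ∧ (a xor b))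
ends-sum = toWitness {a? = ∀Bool? λ a → ∀Bool? λ b → ∀Bool? λ x → ∀Bool? λ y → Product.≡-dec Bool._≟_ Bool._≟_ _ _} _

module NonConflict (G : Graph) (bridgeless : Bridgeless G) (cubic : Cubic G) (claw-free : ClawFree G)
  (F : Fin (m G) → Bool) (perfect : PerfectMatching G F)
  (once : ∀ S → count (Cuts.δ G S) ≡ 3 → wt (Weights.cross G S) F ≡ 1) where
  open Cuts G
  open Weights G
  open Flows G

  A : ES
  A = not ∘ F

  no-odd : ∀ S → Closed A S → count (δ S) ≢ 1 × count (δ S) ≢ 3
  no-odd S c = no-bridge G bridgeless S , λ three → contradiction (trans (sym (once S three)) (trans inside three)) λ ()
    where
    inside : wt (cross S) F ≡ count (δ S)
    inside = sum-cong pointwise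
      where
      pointwise : ∀ e → (if F e then b2n (δ S e) else 0) ≡ b2n (δ S e)
      pointwise e with bool-cases (F e)
      ... | inj₁ p = cong (λ b → if b then b2n (δ S e) else 0) p
      ... | inj₂ p = trans (cong (λ b → if b then b2n (δ S e) else 0) p) (cong b2n (sym (c e (cong not p))))

  the-flow : Flow A
  the-flow = four-flow _ A ≤-refl no-odd

  module _ (X Y : ES) (nonzero : ∀ e → A e ≡ false → X e ∨ Y e ≡ true)
    (orth : ∀ S → Closed A S → dot X S ≡ false × dot Y S ≡ false) where

    loop : ES
    loop f = conn A (end₁ G f) (end₂ G f)

    -- Loops of G / F̄ may take any value; α + β conflicts with nothing.
    θ : E → K
    θ f = if loop f then (true , true) else (X f , Y f)

    θ-nonzero : ∀ f → F f ≡ true → θ f ≢ 0K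
    θ-nonzero f Ff with loop f
    ... | true = λ ()
    ... | false = λ z → true≢false (nonzero f (cong not Ff)) (cong₂ _∨_ (cong proj₁ z) (cong proj₂ z))

    same-conn : ∀ u x → sameCycle G F u x ≡ conn A u x
    same-conn = reachF-cong (λ e → sym (not-involutive (F e))) (n G)

    term : V → E → K
    term u f = if F f
      then ((if sameCycle G F u (end₁ G f) then θ f else 0K) +K (if sameCycle G F u (end₂ G f) then θ f else 0K))
      else 0K

    -- A loop has both or neither of its ends on the cycle of `u`, so its value cancels whatever it
    -- is. An edge of F̄ never leaves that cycle, so the right-hand side vanishes on it as well.
    term-value : ∀ u f → term u f ≡ (X f ∧ δ (conn A u) f , Y f ∧ δ (conn A u) f)
    term-value u f = trans
      (cong₂ (λ a b → if F f then ((if a then θ f else 0K) +K (if b then θ f else 0K)) else 0K)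
        (same-conn u (end₁ G f)) (same-conn u (end₂ G f)))
      (cases (bool-cases (F f)) (bool-cases (loop f)))
      where
      S : VS
      S = conn A u
      a b : Bool
      a = S (end₁ G f)
      b = S (end₂ G f)
      vanish : ∀ {x y d} → d ≡ false → 0K ≡ (x ∧ d , y ∧ d)
      vanish {x} {y} refl = cong₂ _,_ (sym (∧-zeroʳ x)) (sym (∧-zeroʳ y))
      cases : F f ≡ true ⊎ F f ≡ false → loop f ≡ true ⊎ loop f ≡ false →
        (if F f then ((if a then θ f else 0K) +K (if b then θ f else 0K)) else 0K) ≡ (X f ∧ δ S f , Y f ∧ δ S f)
      cases (inj₂ p) _ = trans (cong (λ c → if c then ((if a then θ f else 0K) +K (if b then θ f else 0K)) else 0K) p)
        (vanish (conn-Closed A u f (cong not p)))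
      cases (inj₁ p) l = trans (cong (λ c → if c then ((if a then θ f else 0K) +K (if b then θ f else 0K)) else 0K) p) (on-F l)
        where
        on-F : loop f ≡ true ⊎ loop f ≡ false → (if a then θ f else 0K) +K (if b then θ f else 0K) ≡ (X f ∧ δ S f , Y f ∧ δ S f)
        on-F (inj₂ q) = trans (cong (λ k → (if a then k else 0K) +K (if b then k else 0K))
          (cong (λ c → if c then (true , true) else (X f , Y f)) q)) (ends-sum a b (X f) (Y f))
        on-F (inj₁ q) = trans (cong (λ k → (if a then k else 0K) +K (if b then k else 0K))
          (cong (λ c → if c then (true , true) else (X f , Y f)) q)) (trans (ends-sum a b true true)
          (trans (cong₂ _,_ a≡b a≡b) (vanish a≡b)))
          where
          a≡b : a xor b ≡ false
          a≡b = trans (cong (_xor b) (conn-least A S (conn-Closed A u) q)) (xor-same b)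

    θ-flow : ∀ u → flowSumAt G F θ u ≡ 0K
    θ-flow u = trans (sumK-xsum (term u)) (cong₂ _,_
      (trans (xsum-cong (λ f → cong proj₁ (term-value u f))) (proj₁ (orth (conn A u) (conn-Closed A u))))
      (trans (xsum-cong (λ f → cong proj₂ (term-value u f))) (proj₂ (orth (conn A u) (conn-Closed A u)))))

    Joins : E → V → V → Set
    Joins k a b = joinsB G k a b ≡ true

    star : V → ES
    star v = δ (eqB v)

    joins-sym : ∀ {k a b} → Joins k a b → Joins k b a
    joins-sym {k} {a} {b} j = trans (∨-comm (eqB (end₁ G k) b ∧ eqB (end₂ G k) a) _) j

    joins-≢ : ∀ {k a b} → Joins k a b → a ≢ b
    joins-≢ {k} {a} {b} j refl with joins-ends G k a b j
    ... | inj₁ (p , q) = loopless G k (trans p (sym q))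
    ... | inj₂ (p , q) = loopless G k (trans p (sym q))

    joins-star : ∀ {k a b} → Joins k a b → star a k ≡ true
    joins-star {k} {a} {b} j = trans (δ-joins G (eqB a) j) (cong₂ _xor_ (eqB-refl a) (eqB-≢ (joins-≢ j)))

    star-joins : ∀ {k} a → star a k ≡ true → ∃[ b ] Joins k a b
    star-joins {k} a s with xor-true {eqB a (end₁ G k)} s
    ... | inj₁ (p , _) rewrite eqB-true a _ p = end₂ G k , ∨-trueˡ _ (cong₂ _∧_ (eqB-refl (end₁ G k)) (eqB-refl (end₂ G k)))
    ... | inj₂ (_ , p) rewrite eqB-true a _ p = end₁ G k , ∨-trueʳ (eqB (end₁ G k) (end₂ G k) ∧ eqB (end₂ G k) (end₁ G k)) (cong₂ _∧_ (eqB-refl (end₁ G k)) (eqB-refl (end₂ G k)))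

    star-end : ∀ {k a b} c → Joins k a b → star c k ≡ true → c ≡ a ⊎ c ≡ b
    star-end {k} {a} {b} c j s with xor-true {eqB c a} (trans (sym (δ-joins G (eqB c) j)) s)
    ... | inj₁ (p , _) = inj₁ (eqB-true c a p)
    ... | inj₂ (_ , p) = inj₂ (eqB-true c b p)

    joins-unique : ∀ {k a b c} → Joins k a b → Joins k a c → b ≡ c
    joins-unique {k} {a} {b} {c} j i with star-end b i (joins-star (joins-sym j))
    ... | inj₁ b≡a = ⊥-elim (joins-≢ j (sym b≡a))
    ... | inj₂ b≡c = b≡c

    joins-conn : ∀ {k a b} → F k ≡ false → Joins k a b → conn A a b ≡ true
    joins-conn {k} {a} {b} Fk j = trans
      (sym (xor-false (trans (sym (δ-joins G (conn A a) j)) (conn-Closed A a k (cong not Fk))))) (conn-refl A a)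

    F-at : ∀ v → count (λ e → F e ∧ star v e) ≡ 1
    F-at v = trans (sym (wt-cross (eqB v) F)) (trans (wt-star G v F) (perfect v))

    F-unique : ∀ v {f k} → F f ≡ true → star v f ≡ true → F k ≡ true → star v k ≡ true → f ≡ k
    F-unique v Ff sf Fk sk = count-one (λ e → F e ∧ star v e) (F-at v) _ _ (cong₂ _∧_ Ff sf) (cong₂ _∧_ Fk sk)

    F-star : ∀ v {f} → F f ≡ true → star v f ≡ true → ∀ e → F e ≡ true → star v e ≡ eqB f e
    F-star v {f} Ff sf e Fe = bool-ext
      (λ s → subst (λ k → eqB f k ≡ true) (F-unique v Ff sf Fe s) (eqB-refl f))
      (λ q → subst (λ k → star v k ≡ true) (eqB-true f e q) sf)

    A-at : ∀ v → count (λ e → not (F e) ∧ star v e) ≡ 2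
    A-at v = +-cancelˡ-≡ 1 _ _ (begin
      1 + count (λ e → not (F e) ∧ star v e) ≡⟨ cong (_+ count (λ e → not (F e) ∧ star v e)) (sym (F-at v)) ⟩
      count (λ e → F e ∧ star v e) + count (λ e → not (F e) ∧ star v e) ≡⟨ sym (sum-+ (λ e → b2n (F e ∧ star v e)) (λ e → b2n (not (F e) ∧ star v e))) ⟩
      sumℕ (λ e → b2n (F e ∧ star v e) + b2n (not (F e) ∧ star v e)) ≡⟨ sum-cong (λ e → pointwise (F e) (star v e)) ⟩
      count (star v) ≡⟨ trans (count-star G v) (cubic v) ⟩
      3 ∎)
      where
      open ≡-Reasoning
      pointwise : ∀ a b → b2n (a ∧ b) + b2n (not a ∧ b) ≡ b2n b
      pointwise true b = +-identityʳ _
      pointwise false b = refl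

    A-star : ∀ v {k l} → F k ≡ false → star v k ≡ true → F l ≡ false → star v l ≡ true → k ≢ l →
      ∀ e → F e ≡ false → star v e ≡ eqB k e xor eqB l e
    A-star v {k} {l} Fk sk Fl sl k≢l e Fe =
      let (h , _ , all) = count-two (λ e → not (F e) ∧ star v e) (A-at v) k (cong₂ (λ a b → not a ∧ b) Fk sk)
          h≡l = eqB-true h l (trans (sym (cong (_xor eqB h l) (eqB-≢ k≢l)))
                  (trans (sym (all l)) (cong₂ (λ a b → not a ∧ b) Fl sl)))
      in trans (sym (cong (λ a → not a ∧ star v e) Fe)) (trans (all e) (cong (λ c → eqB k e xor eqB c e) h≡l))

    other : ∀ v {g} → F g ≡ false → star v g ≡ true → ∃[ k ] F k ≡ false × star v k ≡ true × g ≢ k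
    other v {g} Fg sg =
      let (k , Qk , all) = count-two (λ e → not (F e) ∧ star v e) (A-at v) g (cong₂ (λ a b → not a ∧ b) Fg sg)
      in k , not-true (proj₁ (∧-true Qk)) , proj₂ (∧-true {not (F k)} Qk) , λ g≡k →
        true≢false Qk (trans (all k) (trans (cong (λ c → eqB c k xor eqB k k) g≡k) (xor-same (eqB k k))))

    NoLoop : E → Set
    NoLoop f = ∀ {a b} → Joins f a b → conn A a b ≡ true → ⊥

    -- The product of the coordinates is 1 for the loop value α + β but 0 for α and β, so an edge
    -- with one of the latter values joins different cycles.
    value-loop : ∀ f x y → θ f ≡ (x , y) → x ∧ y ≡ false → NoLoop f × X f ≡ x
    value-loop f x y eq xy with bool-cases (loop f)
    ... | inj₁ l = contradiction (trans (sym xy) (cong (λ k → proj₁ k ∧ proj₂ k) (trans (sym eq)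
        (cong (λ c → if c then (true , true) else (X f , Y f)) l)))) λ ()
    ... | inj₂ l = no-loop , cong proj₁ (trans (sym (cong (λ c → if c then (true , true) else (X f , Y f)) l)) eq)
      where
      no-loop : NoLoop f
      no-loop {a} {b} j c with joins-ends G f a b j
      ... | inj₁ (refl , refl) = true≢false c l
      ... | inj₂ (refl , refl) = true≢false (conn-sym A c) l

    mult-one : ∀ {u v k} → Joins k u v → (∀ l → Joins l u v → l ≡ k) → mult G u v ≡ 1
    mult-one {u} {v} {k} j uniq = ≤-antisym
      (count-unique (λ l → joinsB G l u v) (λ a b p q → trans (uniq a p) (sym (uniq b q))))
      (count-pos (λ l → joinsB G l u v) k j)

    -- Of the values α on `f₁` and β on `f₂` only the first coordinates are kept, as these already
    -- differ. The case split is on the end `p` of the other F̄-edge at `u`.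
    module Conflict (g : E) (Fg : F g ≡ false) (u v : V) (jg : Joins g u v)
      (f₁ f₂ : E) (Ff₁ : F f₁ ≡ true) (Ff₂ : F f₂ ≡ true) (q r : V) (j₁ : Joins f₁ u q) (j₂ : Joins f₂ v r)
      (nl₁ : NoLoop f₁) (nl₂ : NoLoop f₂) (X₁ : X f₁ ≡ true) (X₂ : X f₂ ≡ false) where

      f₁≢f₂ : f₁ ≢ f₂
      f₁≢f₂ refl = true≢false X₁ X₂

      uv : conn A u v ≡ true
      uv = joins-conn Fg jg

      F-not-A : ∀ {f k} → F f ≡ true → F k ≡ false → f ≢ k
      F-not-A p q refl = true≢false p q

      -- f₁ and f₂ form the cut around u and v, so the flow gives them equal values.
      digon : ∀ k → F k ≡ false → Joins k u v → g ≢ k → ⊥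
      digon k Fk jk g≢k = true≢false (cong₂ _xor_ X₁ X₂)
          (trans (sym X-sum) (proj₁ (orth S closed)))
        where
        S : VS
        S = eqB u ⊕ eqB v
        closed : Closed A S
        closed e Ae = trans (δ-⊕ (eqB u) (eqB v) e) (trans (cong₂ _xor_
          (A-star u Fg (joins-star jg) Fk (joins-star jk) g≢k e (not-true Ae))
          (A-star v Fg (joins-star (joins-sym jg)) Fk (joins-star (joins-sym jk)) g≢k e (not-true Ae))) (xor-same (eqB g e xor eqB k e)))
        δS : ∀ e → δ S e ≡ (eqB f₁ ⊕ eqB f₂) e
        δS e with bool-cases (F e)
        ... | inj₁ Fe = trans (δ-⊕ (eqB u) (eqB v) e)
          (cong₂ _xor_ (F-star u Ff₁ (joins-star j₁) e Fe) (F-star v Ff₂ (joins-star j₂) e Fe))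
        ... | inj₂ Fe = trans (closed e (cong not Fe)) (sym (cong₂ _xor_ (eqB-≢ (F-not-A Ff₁ Fe)) (eqB-≢ (F-not-A Ff₂ Fe))))
        X-sum : dot X S ≡ X f₁ xor X f₂
        X-sum = trans (xsum-cong (λ e → trans (cong (X e ∧_) (δS e)) (trans (∧-comm (X e) _) (∧-distribʳ-xor (X e) (eqB f₁ e) (eqB f₂ e)))))
          (trans (xsum-xor (λ e → eqB f₁ e ∧ X e) (λ e → eqB f₂ e ∧ X e)) (cong₂ _xor_ (xsum-eqB f₁ X) (xsum-eqB f₂ X)))

      module _ (p : V) (h : E) (Fh : F h ≡ false) (jh : Joins h u p) (g≢h : g ≢ h) (p≢v : p ≢ v) where

        up : conn A u p ≡ true
        up = joins-conn Fh jh

        q≢v : q ≢ v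
        q≢v refl = nl₁ j₁ uv

        q≢p : q ≢ p
        q≢p refl = nl₁ j₁ up

        at-u : ∀ k → star u k ≡ true → k ≡ f₁ ⊎ (k ≡ g ⊎ k ≡ h)
        at-u k s with bool-cases (F k)
        ... | inj₁ Fk = inj₁ (sym (F-unique u Ff₁ (joins-star j₁) Fk s))
        ... | inj₂ Fk with xor-true {eqB g k} (trans (sym (A-star u Fg (joins-star jg) Fh (joins-star jh) g≢h k Fk)) s)
        ...   | inj₁ (a , _) = inj₂ (inj₁ (sym (eqB-true g k a)))
        ...   | inj₂ (_ , a) = inj₂ (inj₂ (sym (eqB-true h k a)))

        mult-uv : mult G u v ≡ 1
        mult-uv = mult-one jg λ l j → pick l j (at-u l (joins-star j))
          where
          pick : ∀ l → Joins l u v → l ≡ f₁ ⊎ (l ≡ g ⊎ l ≡ h) → l ≡ g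
          pick l j (inj₁ refl) = ⊥-elim (q≢v (joins-unique j₁ j))
          pick l j (inj₂ (inj₁ e)) = e
          pick l j (inj₂ (inj₂ refl)) = ⊥-elim (p≢v (joins-unique jh j))

        mult-up : mult G u p ≡ 1
        mult-up = mult-one jh λ l j → pick l j (at-u l (joins-star j))
          where
          pick : ∀ l → Joins l u p → l ≡ f₁ ⊎ (l ≡ g ⊎ l ≡ h) → l ≡ h
          pick l j (inj₁ refl) = ⊥-elim (q≢p (joins-unique j₁ j))
          pick l j (inj₂ (inj₁ refl)) = ⊥-elim (p≢v (joins-unique j jg))
          pick l j (inj₂ (inj₂ e)) = e

        mult-uq : mult G u q ≡ 1
        mult-uq = mult-one j₁ λ l j → pick l j (at-u l (joins-star j))
          where
          pick : ∀ l → Joins l u q → l ≡ f₁ ⊎ (l ≡ g ⊎ l ≡ h) → l ≡ f₁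
          pick l j (inj₁ e) = e
          pick l j (inj₂ (inj₁ refl)) = ⊥-elim (q≢v (joins-unique j jg))
          pick l j (inj₂ (inj₂ refl)) = ⊥-elim (q≢p (joins-unique j jh))

        -- `q` lies on another cycle of F̄, so only an edge of `F` could join it to `v`. That edge
        -- would be `f₁`, seen from `q`, and `f₂`, seen from `v`.
        no-vq : ∀ k → Joins k v q → ⊥
        no-vq k j with bool-cases (F k)
        ... | inj₂ Fk = nl₁ j₁ (conn-trans A uv (joins-conn Fk j))
        ... | inj₁ Fk = f₁≢f₂ (trans (F-unique q Ff₁ (joins-star (joins-sym j₁)) Fk (joins-star (joins-sym j)))
          (F-unique v Fk (joins-star j) Ff₂ (joins-star j₂)))

        f₁-off-p : star p f₁ ≡ true → ⊥
        f₁-off-p s with star-end p j₁ s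
        ... | inj₁ p≡u = joins-≢ jh (sym p≡u)
        ... | inj₂ p≡q = q≢p (sym p≡q)

        no-pq : ∀ k → Joins k p q → ⊥
        no-pq k j with bool-cases (F k)
        ... | inj₂ Fk = nl₁ j₁ (conn-trans A up (joins-conn Fk j))
        ... | inj₁ Fk = f₁-off-p (subst (λ l → star p l ≡ true)
          (F-unique q Fk (joins-star (joins-sym j)) Ff₁ (joins-star (joins-sym j₁))) (joins-star j))

        -- `p` lies on the cycle of `v`, and `f₂` leaves that cycle.
        f₂-off-p : star p f₂ ≡ true → ⊥
        f₂-off-p s with star-end p j₂ s
        ... | inj₁ p≡v = p≢v p≡v
        ... | inj₂ refl = nl₂ j₂ (conn-trans A (conn-sym A uv) up)

        -- The three edges leaving the triangle u v p would form a 3-cut contained in F.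
        triangle : ∀ k → F k ≡ false → Joins k v p → ⊥
        triangle k Fk j = proj₂ (no-odd S closed) (begin
            count (δ S) ≡⟨ count-cong δS ⟩
            count (eqB f₁ ⊕ eqB f₂ ⊕ eqB f₃) ≡⟨ sum-cong (λ e → as-wt ((eqB f₁ ⊕ eqB f₂ ⊕ eqB f₃) e)) ⟩
            wt ones (eqB f₁ ⊕ eqB f₂ ⊕ eqB f₃) ≡⟨ wt-disjoint ones (λ e a → inj₁ (f₃-disjoint e a)) ⟩
            wt ones (eqB f₁ ⊕ eqB f₂) + wt ones (eqB f₃) ≡⟨ cong₂ _+_ (wt-disjoint ones (λ e a → inj₁ (apart f₁≢f₂ e a))) (wt-eqB ones f₃) ⟩
            wt ones (eqB f₁) + wt ones (eqB f₂) + 1 ≡⟨ cong (_+ 1) (cong₂ _+_ (wt-eqB ones f₁) (wt-eqB ones f₂)) ⟩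
            3 ∎)
          where
          open ≡-Reasoning
          S : VS
          S = eqB u ⊕ eqB v ⊕ eqB p
          ones : E → ℕ
          ones _ = 1
          as-wt : ∀ b → b2n b ≡ (if b then 1 else 0)
          as-wt true = refl
          as-wt false = refl
          third : ∃[ f ] (F f ∧ star p f) ≡ true
          third = count-witness _ (≤-reflexive (sym (F-at p)))
          f₃ : E
          f₃ = proj₁ third
          Ff₃ : F f₃ ≡ true
          Ff₃ = proj₁ (∧-true (proj₂ third))
          s₃ : star p f₃ ≡ true
          s₃ = proj₂ (∧-true {F f₃} (proj₂ third))
          f₁≢f₃ : f₁ ≢ f₃
          f₁≢f₃ eq = f₁-off-p (trans (cong (star p) eq) s₃)
          f₂≢f₃ : f₂ ≢ f₃
          f₂≢f₃ eq = f₂-off-p (trans (cong (star p) eq) s₃)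
          apart : ∀ {a b : E} → a ≢ b → ∀ e → eqB a e ≡ true → eqB b e ≡ false
          apart {a} {b} a≢b e q = eqB-≢ λ b≡e → a≢b (trans (eqB-true a e q) (sym b≡e))
          f₃-disjoint : ∀ e → (eqB f₁ ⊕ eqB f₂) e ≡ true → eqB f₃ e ≡ false
          f₃-disjoint e a with xor-true {eqB f₁ e} a
          ... | inj₁ (b , _) = apart f₁≢f₃ e b
          ... | inj₂ (_ , b) = apart f₂≢f₃ e b
          g≢k : g ≢ k
          g≢k refl = joins-≢ jh (joins-unique (joins-sym jg) j)
          h≢k : h ≢ k
          h≢k refl = joins-≢ jg (joins-unique (joins-sym jh) (joins-sym j))
          δ-sum : ∀ e → δ S e ≡ (star u e xor star v e) xor star p e
          δ-sum e = trans (δ-⊕ (eqB u ⊕ eqB v) (eqB p) e) (cong (_xor star p e) (δ-⊕ (eqB u) (eqB v) e))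
          cyclic : ∀ a b c → ((a xor b) xor (a xor c)) xor (b xor c) ≡ false
          cyclic = toWitness {a? = ∀Bool? λ a → ∀Bool? λ b → ∀Bool? λ c → _ Bool.≟ _} _
          closed : Closed A S
          closed e Ae = trans (δ-sum e) (trans (cong₂ _xor_ (cong₂ _xor_
            (A-star u Fg (joins-star jg) Fh (joins-star jh) g≢h e (not-true Ae))
            (A-star v Fg (joins-star (joins-sym jg)) Fk (joins-star j) g≢k e (not-true Ae)))
            (A-star p Fh (joins-star (joins-sym jh)) Fk (joins-star (joins-sym j)) h≢k e (not-true Ae)))
            (cyclic (eqB g e) (eqB h e) (eqB k e)))
          δS : ∀ e → δ S e ≡ (eqB f₁ ⊕ eqB f₂ ⊕ eqB f₃) e
          δS e with bool-cases (F e)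
          ... | inj₁ Fe = trans (δ-sum e) (cong₂ _xor_ (cong₂ _xor_
            (F-star u Ff₁ (joins-star j₁) e Fe) (F-star v Ff₂ (joins-star j₂) e Fe)) (F-star p Ff₃ s₃ e Fe))
          ... | inj₂ Fe = trans (closed e (cong not Fe)) (sym (cong₂ _xor_
            (cong₂ _xor_ (eqB-≢ (F-not-A Ff₁ Fe)) (eqB-≢ (F-not-A Ff₂ Fe))) (eqB-≢ (F-not-A Ff₃ Fe))))

        no-vp : ∀ k → Joins k v p → ⊥
        no-vp k j with bool-cases (F k)
        ... | inj₂ Fk = triangle k Fk j
        ... | inj₁ Fk = f₂-off-p (subst (λ l → star p l ≡ true)
          (F-unique v Fk (joins-star j) Ff₂ (joins-star j₂)) (joins-star (joins-sym j)))

        none : ∀ {a b} → (∀ k → Joins k a b → ⊥) → mult G a b ≡ 0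
        none absent = count-empty λ k → ≢true (absent k)

        claw : ⊥
        claw = claw-free (u , v , p , q ,
          (joins-≢ jg , joins-≢ jh , joins-≢ j₁ , (λ e → p≢v (sym e)) , (λ e → q≢v (sym e)) , (λ e → q≢p (sym e))) ,
          (mult-uv , mult-up , mult-uq) , (none no-vp , none no-vq , none no-pq))

      absurd : ⊥
      absurd =
        let (h , Fh , sh , g≢h) = other u Fg (joins-star jg)
            (p , jh) = star-joins u sh
        in decide p h Fh jh g≢h (p ≟ v)
        where
        decide : ∀ p h → F h ≡ false → Joins h u p → g ≢ h → Dec (p ≡ v) → ⊥
        decide p h Fh jh g≢h (yes p≡v) = digon h Fh (subst (λ w → Joins h u w) p≡v jh) g≢h
        decide p h Fh jh g≢h (no p≢v) = claw p h Fh jh g≢h p≢v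

    at-star : ∀ {f v} → end₁ G f ≡ v ⊎ end₂ G f ≡ v → star v f ≡ true
    at-star {f} {v} (inj₁ refl) = cong₂ _xor_ (eqB-refl v) (eqB-≢ (loopless G f))
    at-star {f} {v} (inj₂ refl) = cong₂ _xor_ (eqB-≢ (λ e → loopless G f (sym e))) (eqB-refl v)

    θ-nonconflicting : NonConflicting G F θ
    θ-nonconflicting g Fg u v jg f₁ f₂ (Ff₁ , at₁) (Ff₂ , at₂) (eq₁ , eq₂) =
      let (q , j₁) = star-joins u (at-star at₁)
          (r , j₂) = star-joins v (at-star at₂)
          (nl₁ , X₁) = value-loop f₁ true false eq₁ refl
          (nl₂ , X₂) = value-loop f₂ false true eq₂ refl
      in Conflict.absurd g Fg u v jg f₁ f₂ Ff₁ Ff₂ q r j₁ j₂ nl₁ nl₂ X₁ X₂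

theorem3 : (G : Graph) → ClawFree G → Bridgeless G → Cubic G →
    (e : Fin (Graph.m G)) →
    Σ (EdgeSet G) (λ F → PerfectMatching G F × F e ≡ true ×
    Σ (Fin (Graph.m G) → K) (λ θ → NZFlow G F θ × NonConflicting G F θ))
theorem3 G claw-free bridgeless cubic e =
  let module M = Matching G bridgeless cubic e
      module N = NonConflict G bridgeless cubic claw-free M.J M.perfect M.once
      (X , Y , nonzero , orth) = N.the-flow
  in M.J , M.perfect , M.e∈J , N.θ X Y nonzero orth ,
     (N.θ-nonzero X Y nonzero orth , N.θ-flow X Y nonzero orth) , N.θ-nonconflicting X Y nonzero orth
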